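{- Let $\mathbf k$ be a field and $\vec\alpha=(\alpha^{(1)},\dots,\alpha^{(\ell)})$ a sequence of compositions with $|\alpha^{(1)}|+\dots+|\alpha^{(\ell)}|=n$. Then the sequence $(\mathcal C(\vec\alpha),\partial)$ defined below is a cochain complex of $\mathcal H_n(0)$-modules which is acyclic in strictly positive cohomological degrees, and \[H^0(\mathcal C(\vec\alpha))\cong\mathbf P_{\alpha^{(1)}\cdot\alpha^{(2)}\cdots\alpha^{(\ell)}}.\]
   Context: For $N\ge0$, $\mathcal H_N(0)$ is the $\mathbf k$-algebra generated by $\pi_1,\dots,\pi_{N-1}$ with $\pi_i^2=\pi_i$, $\pi_i\pi_{i+1}\pi_i=\pi_{i+1}\pi_i\pi_{i+1}$, $\pi_i\pi_j=\pi_j\pi_i$ for $|i-j|>1$; $\bar\pi_i=\pi_i-1$. A composition $\alpha=(\alpha_1,\dots,\alpha_k)\vDash n$ is a sequence of positive integers with sum $n$. The ribbon $\mathrm{Diag}(\alpha)$ is the connected diagram with $k$ rows, the $i$-th row from the bottom having $\alpha_i$ boxes, the leftmost box of row $i+1$ lying directly above the rightmost box of row $i$. For a sequence of compositions $\vec\gamma=(\gamma^{(1)},\dots,\gamma^{(s)})$, the generalized ribbon $\mathrm{Diag}(\vec\gamma)$ is the disjoint union of the ribbons $\mathrm{Diag}(\gamma^{(j)})$, placed so that for each $j$ the southwesternmost box of the $(j+1)$-st component lies one row above and one column to the right of the northeasternmost box of the $j$-th component. For a finite diagram $D$ of $N$ boxes, a standard tableau of shape $D$ is a bijective filling by $1,\dots,N$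 strictly increasing left to right between horizontally adjacent boxes and strictly increasing top to bottom between vertically adjacent boxes. $\mathbf P_D$ is the $\mathbf k$-space with basis the standard tableaux of shape $D$ and $\mathcal H_N(0)$-action $\bar\pi_iT=-T$ if $i$ is in a higher row than $i+1$, $0$ if in the same row, $s_i(T)$ (swap $i,i+1$) if $i$ is in a lower row. Write $\mathbf P_{\vec\gamma}=\mathbf P_{\mathrm{Diag}(\vec\gamma)}$ and $\mathbf P_\alpha=\mathbf P_{\mathrm{Diag}(\alpha)}$. Concatenation $\alpha\cdot\beta=(\alpha_1,\dots,\alpha_\ell,\beta_1,\dots,\beta_r)$; near-concatenation $\alpha\odot\beta=(\alpha_1,\dots,\alpha_{\ell-1},\alpha_\ell+\beta_1,\beta_2,\dots,\beta_r)$. Geometrically $\mathrm{Diag}(\alpha\odot\beta)$ arises from the two-component $\mathrm{Diag}(\alpha,\beta)$ by translating the $\beta$-component one unit down, so that the northeasternmost box of the $\alpha$-part is immediately left of the southwesternmost box of the $\beta$-part. For $I\subseteq[\ell-1]$, $\vec\alpha(I)$ is the sequence of $\ell-|I|$ compositions obtained from $\vec\alpha$ by replacing, for each $i\in I$, the $i$-th comma (between $\alpha^{(i)}$ and $\alpha^{(i+1)}$) by $\odot$. Set $\mathcal C_i(\vec\alpha)=\bigoplus_{I\subseteq[\ell-1],|I|=i}\mathbf P_{\vec\alpha(I)}$ (in cohomological degree $i$). For $j\in[\ell-1]\setminus I$ and a standard tableau $T$ of shape $\mathrm{Diag}(\vec\alpha(I))$, let $\phi_j(T)\in\mathbf P_{\vec\alpha(I\cup\{j\})}$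 be the filling obtained by gluing the two components separated by the $j$-th comma via near-concatenation (the entries of each box kept, the other components unchanged), if that filling is standard, and $0$ otherwise. With $I=\{i_1<\dots<i_r\}$ and $\mathrm{sgn}(j,I)=(-1)^{\#\{t:i_t<j\}}$, define $\partial_i:\mathcal C_i(\vec\alpha)\to\mathcal C_{i+1}(\vec\alpha)$ by $\partial_i(T)=\sum_{j\in[\ell-1]\setminus I}\mathrm{sgn}(j,I)\phi_j(T)$ for $T\in\mathbf P_{\vec\alpha(I)}$. -}

module Defs where

open import Level using (_⊔_) renaming (suc to lsuc)
open import Data.Nat using (ℕ; zero; suc; _∸_; _<_; _≤_; _<ᵇ_; _≡ᵇ_)
import Data.Nat as ℕ
open import Data.Bool using (Bool; true; false; if_then_else_; _∧_; not)
import Data.Bool as 𝔹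
open import Data.Fin using (Fin; zero; suc)
open import Data.Fin.Subset using (Subset; _∪_; ⁅_⁆; ∣_∣)
open import Data.List using (List; []; _∷_; _++_; length; map; concatMap; concat; upTo; filterᵇ; zip)
open import Data.Nat.ListAction using (sum)
open import Data.Bool.ListAction using (all)
import Data.List.Properties as LP
open import Data.List.Relation.Unary.All using (All)
open import Data.Vec using (Vec; []; _∷_; toList; lookup)
import Data.Vec.Properties as VP
open import Data.Product using (_×_; _,_; ∃; proj₁; proj₂)
open import Data.Sum using (_⊎_)
open import Relation.Nullary using (¬_; does)
open import Relation.Binary.PropositionalEquality using (_≡_)
open import Algebra.Bundles using (CommutativeRing)

record Field c ℓ : Set (lsuc (c ⊔ ℓ)) where
  field
    commutativeRing : CommutativeRing c ℓ
  open CommutativeRing commutativeRing public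
  field
    0≉1     : ¬ (0# ≈ 1#)
    inverse : ∀ x → ¬ (x ≈ 0#) → ∃ λ y → x * y ≈ 1#

IsNonemptyComposition : List ℕ → Set
IsNonemptyComposition γ = (0 < length γ) × All (0 <_) γ

size : ∀ {ℓ} → Vec (List ℕ) ℓ → ℕ
size αs = sum (map sum (toList αs))

concatAll : ∀ {ℓ} → Vec (List ℕ) ℓ → List ℕ
concatAll αs = concat (toList αs)

-- near-concatenation α ⊙ β (only meaningful for nonempty α, β)
_⊙_ : List ℕ → List ℕ → List ℕ
[] ⊙ β = β
(a ∷ []) ⊙ [] = a ∷ []
(a ∷ []) ⊙ (b ∷ β) = (a ℕ.+ b) ∷ β
(a ∷ a′ ∷ α) ⊙ β = a ∷ ((a′ ∷ α) ⊙ β)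

-- α⃗(I): replace the i-th comma by ⊙ for each i ∈ I
-- (comma i, between α⁽ⁱ⁾ and α⁽ⁱ⁺¹⁾, is the element (i-1) of Fin m, ℓ = m+1)
glue : ∀ {m} → List ℕ → Vec (List ℕ) m → Subset m → List (List ℕ)
glue α [] [] = α ∷ []
glue α (β ∷ βs) (true ∷ I) = glue (α ⊙ β) βs I
glue α (β ∷ βs) (false ∷ I) = α ∷ glue β βs I

seqAt : ∀ {m} → Vec (List ℕ) (suc m) → Subset m → List (List ℕ)
seqAt (α ∷ αs) I = glue α αs I

-- A cell is (x , y) = (column , row); rows are counted from the bottom.
Cell : Set
Cell = ℕ × ℕ

rowCells : ℕ → ℕ → ℕ → List Cell
rowCells x y zero = []
rowCells x y (suc a) = (x , y) ∷ rowCells (suc x) y a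

-- ribbon of a composition whose first row starts at (x , y);
-- the next row starts directly above the last box of the current row.
ribbon : ℕ → ℕ → List ℕ → List Cell
ribbon x y [] = []
ribbon x y (a ∷ as) = rowCells x y a ++ ribbon (x ℕ.+ a ∸ 1) (suc y) as

endX : ℕ → List ℕ → ℕ
endX x [] = x
endX x (a ∷ as) = endX (x ℕ.+ a ∸ 1) as

-- generalized ribbon: the next component starts one row above and one
-- column right of the northeasternmost box of the previous one.
genRibbon : ℕ → ℕ → List (List ℕ) → List Cell
genRibbon x y [] = []
genRibbon x y (γ ∷ γs) =
  ribbon x y γ ++ genRibbon (suc (endX x γ)) (y ℕ.+ length γ) γs

-- Diag(γ⃗): list of cells, in reading order (rows bottom to top,
-- each row left to right, components in order)
Diag : List (List ℕ) → List Cell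
Diag = genRibbon 0 0

-- Tableaux.  A filling of a diagram D is the list of entries of its
-- cells, in the order of the list D.

Filling : Set
Filling = List ℕ

insertions : ℕ → List ℕ → List (List ℕ)
insertions x [] = (x ∷ []) ∷ []
insertions x (y ∷ ys) = (x ∷ y ∷ ys) ∷ map (y ∷_) (insertions x ys)

perms : List ℕ → List (List ℕ)
perms [] = [] ∷ []
perms (x ∷ xs) = concatMap (insertions x) (perms xs)

oneTo : ℕ → List ℕ
oneTo N = map suc (upTo N)

okPair : Cell × ℕ → Cell × ℕ → Bool
okPair ((x , y) , e) ((x′ , y′) , e′) =
  (if (y ≡ᵇ y′) ∧ (suc x ≡ᵇ x′) then e <ᵇ e′ else true) ∧
  (if (x ≡ᵇ x′) ∧ (y ≡ᵇ suc y′) then e <ᵇ e′ else true)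

isStandardᵇ : List Cell → Filling → Bool
isStandardᵇ D T = let ps = zip D T in all (λ p → all (okPair p) ps) ps

syt : List Cell → List Filling
syt D = filterᵇ (isStandardᵇ D) (perms (oneTo (length D)))

dim : List Cell → ℕ
dim D = length (syt D)

Basis : List Cell → Set
Basis D = Fin (dim D)

tab : (D : List Cell) → Basis D → Filling
tab D t = Data.List.lookup (syt D) t

rowOf : List Cell → Filling → ℕ → ℕ
rowOf [] _ e = 0
rowOf (_ ∷ _) [] e = 0
rowOf ((x , y) ∷ D) (t ∷ T) e = if t ≡ᵇ e then y else rowOf D T e

swapEntries : ℕ → Filling → Filling
swapEntries i = map (λ t → if t ≡ᵇ i then suc i else (if t ≡ᵇ suc i then i else t))

_==F_ : Filling → Filling → Bool
T ==F T′ = does (LP.≡-dec ℕ._≟_ T T′)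

_==S_ : ∀ {m} → Subset m → Subset m → Bool
I ==S I′ = does (VP.≡-dec 𝔹._≟_ I I′)

countBelow : ∀ {m} → Subset m → Fin m → ℕ
countBelow (b ∷ I) zero = 0
countBelow (b ∷ I) (suc j) = (if b then 1 else 0) ℕ.+ countBelow I j

module _ {c ℓ} (F : Field c ℓ) where
  open Field F using (Carrier; _≈_; _+_; _*_; -_; 0#; 1#)

  sumFin : ∀ {k} → (Fin k → Carrier) → Carrier
  sumFin {zero} f = 0#
  sumFin {suc k} f = f zero + sumFin (λ i → f (suc i))

  sumSub : ∀ {m} → (Subset m → Carrier) → Carrier
  sumSub {zero} f = f []
  sumSub {suc m} f = sumSub (λ I → f (false ∷ I)) + sumSub (λ I → f (true ∷ I))

  ind : Bool → Carrier
  ind b = if b then 1# else 0#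

  sgnPow : ℕ → Carrier
  sgnPow zero = 1#
  sgnPow (suc k) = - sgnPow k

  P : List Cell → Set c
  P D = Basis D → Carrier

  coefπ̄ : (D : List Cell) → ℕ → Basis D → Basis D → Carrier
  coefπ̄ D i t′ t =
    let T = tab D t ; ri = rowOf D T i ; ri₁ = rowOf D T (suc i) in
    if ri₁ <ᵇ ri then - ind (tab D t′ ==F T)
    else (if ri <ᵇ ri₁ then ind (tab D t′ ==F swapEntries i T) else 0#)

  π̄ : (D : List Cell) → ℕ → P D → P D
  π̄ D i v t′ = sumFin (λ t → coefπ̄ D i t′ t * v t)

  π : (D : List Cell) → ℕ → P D → P D
  π D i v t′ = π̄ D i v t′ + v t′

  module Complex {m : ℕ} (αs : Vec (List ℕ) (suc m)) where

    shape : Subset m → List Cell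
    shape I = Diag (seqAt αs I)

    C : Set c
    C = (I : Subset m) → P (shape I)

    _≈C_ : C → C → Set ℓ
    v ≈C w = ∀ I t → v I t ≈ w I t

    0C : C
    0C I t = 0#

    _+C_ : C → C → C
    (v +C w) I t = v I t + w I t

    _·C_ : Carrier → C → C
    (a ·C v) I t = a * v I t

    InDegree : ℕ → C → Set ℓ
    InDegree d v = ∀ I → ¬ (∣ I ∣ ≡ d) → ∀ t → v I t ≈ 0#

    πC : ℕ → C → C
    πC i v I = π (shape I) i (v I)

    -- ∂(T) = Σ_{j ∉ I} sgn(j,I) φ_j(T), extended linearly; the
    -- coefficient of t′ ∈ 𝐏_{α⃗(I′)} collects the contributions of all
    -- (I , j) with j ∉ I and I ∪ {j} = I′; φ_j keeps the filling, and
    -- is 0 unless it is standard of the new shape.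
    ∂ : C → C
    ∂ v I′ t′ =
      sumSub (λ I → sumFin (λ j →
        ind (not (lookup I j) ∧ ((I ∪ ⁅ j ⁆) ==S I′)) *
        (sgnPow (countBelow I j) *
         sumFin (λ t → v I t * ind (tab (shape I) t ==F tab (shape I′) t′)))))

    shapeCat : List Cell
    shapeCat = Diag (concatAll αs ∷ [])

    _≈P_ : P shapeCat → P shapeCat → Set ℓ
    u ≈P w = ∀ t → u t ≈ w t

    Gen : ℕ → ℕ → Set
    Gen n i = 1 ≤ i × i < n

    IsCochainComplexOfModules : ℕ → Set (c ⊔ ℓ)
    IsCochainComplexOfModules n =
      -- each 𝒞 is an ℋ_n(0)-module (defining relations of ℋ_n(0))
      (∀ i → Gen n i → ∀ v → πC i (πC i v) ≈C πC i v) ×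
      (∀ i → Gen n i → Gen n (suc i) → ∀ v →
         πC i (πC (suc i) (πC i v)) ≈C πC (suc i) (πC i (πC (suc i) v))) ×
      (∀ i j → Gen n i → Gen n j → (suc i < j ⊎ suc j < i) → ∀ v →
         πC i (πC j v) ≈C πC j (πC i v)) ×
      (∀ d v → InDegree d v → InDegree (suc d) (∂ v)) ×
      (∀ v w → ∂ (v +C w) ≈C (∂ v +C ∂ w)) ×
      (∀ a v → ∂ (a ·C v) ≈C (a ·C ∂ v)) ×
      (∀ i → Gen n i → ∀ v → ∂ (πC i v) ≈C πC i (∂ v)) ×
      (∀ v → ∂ (∂ v) ≈C 0C)

    IsAcyclicInPositiveDegrees : Set (c ⊔ ℓ)
    IsAcyclicInPositiveDegrees =
      ∀ d v → InDegree (suc d) v → ∂ v ≈C 0C →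
        ∃ λ w → InDegree d w × ∂ w ≈C v

    -- H^0(𝒞) = ker(∂ : 𝒞_0 → 𝒞_1) ≅ 𝐏_{α⁽¹⁾⋯α⁽ℓ⁾} as ℋ_n(0)-modules:
    -- an injective module map 𝐏_{α⁽¹⁾⋯α⁽ℓ⁾} → 𝒞_0 with image ker ∂.
    H0Iso : ℕ → Set (c ⊔ ℓ)
    H0Iso n = ∃ λ (f : P shapeCat → C) →
      (∀ u w → u ≈P w → f u ≈C f w) ×
      (∀ u w → f (λ t → u t + w t) ≈C (f u +C f w)) ×
      (∀ a u → f (λ t → a * u t) ≈C (a ·C f u)) ×
      (∀ i → Gen n i → ∀ u → f (π shapeCat i u) ≈C πC i (f u)) ×
      (∀ u → InDegree 0 (f u)) ×
      (∀ u → ∂ (f u) ≈C 0C) ×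
      (∀ u w → f u ≈C f w → u ≈P w) ×
      (∀ v → InDegree 0 v → ∂ v ≈C 0C → ∃ λ u → f u ≈C v)

{-# OPTIONS --safe #-}
module Submission where

-- Read along the diagram, a filling becomes a word, and standardness constrains only consecutive letters:
-- an ascent inside a row, a descent between rows of a component, nothing at a comma, and an ascent at a
-- glued comma.  So a word T satisfying the constraints inside the components is standard for α⃗(I) exactly
-- when I ⊆ A(T), the set of commas at which T ascends, and 𝒞 splits as a vector space into the cochain
-- complexes of the full simplices on the A(T).  These are contractible unless A(T) = ∅, that is, unless T
-- descends at every comma, which says that T is standard for α⁽¹⁾⋯α⁽ℓ⁾.
--
-- A vector of 𝐏_D is extended by zero to all fillings.  Then π_i is precomposition with the operation that
-- exchanges i and i+1 when i+1 lies in the lower row; the Hecke relations become the relations of sorting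
-- operators, and ∂ commutes with π_i because on a standard filling this operation only depends on the word.

open import Defs
open import Algebra.Bundles using (CommutativeRing)
open import Data.Bool using (Bool; true; false; if_then_else_; _∧_; not; T; f≤t; b≤b)
import Data.Bool as 𝔹
import Data.Bool.Properties as 𝔹
open import Data.Empty using (⊥-elim)
open import Data.Fin using (Fin; zero; suc)
open import Data.Fin.Subset using (Subset; _∪_; ⁅_⁆; ∣_∣; ⊥)
import Data.Fin.Subset.Properties as Subset
open import Data.List using (List; []; _∷_; _++_; length; map; upTo; zip; replicate)
import Data.List.Properties as List
open import Data.List.Membership.Propositional using (_∈_; _∉_; find; lose)
import Data.List.Membership.Propositional.Properties as ∈
open import Data.List.Relation.Binary.BagAndSetEquality using (∼bag⇒↭)
open import Data.List.Membership.Propositional.Properties.WithK using (unique∧set⇒bag)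
open import Data.List.Relation.Binary.Disjoint.Propositional using (Disjoint)
open import Data.List.Relation.Binary.Permutation.Propositional using (_↭_; prep; swap; ↭-refl; ↭-sym; ↭-trans; ↭⇒↭ₛ)
import Data.List.Relation.Binary.Permutation.Propositional.Properties as ↭
import Data.List.Relation.Binary.Permutation.Setoid.Properties as ↭ₛ
open import Data.List.Relation.Unary.All using (All; []; _∷_)
import Data.List.Relation.Unary.All as All
import Data.List.Relation.Unary.All.Properties as All
open import Data.List.Relation.Unary.AllPairs using (AllPairs; []; _∷_)
import Data.List.Relation.Unary.AllPairs.Properties as AllPairs
open import Data.List.Relation.Unary.Any using (here; there)
import Data.List.Relation.Unary.Any as Any
import Data.List.Relation.Unary.Any.Properties as Any
open import Data.List.Relation.Unary.Unique.Propositional using (Unique)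
import Data.List.Relation.Unary.Unique.Propositional.Properties as Unique
open import Data.Nat using (ℕ; zero; suc; pred; _∸_; _<_; _≤_; _<ᵇ_; _≡ᵇ_; z≤n; s≤s)
import Data.Nat as ℕ
import Data.Nat.Properties as ℕ
open import Data.Nat.ListAction using (sum)
open import Data.Product using (_×_; _,_; ∃; proj₁; proj₂)
open import Data.Sum using ([_,_]′)
open import Data.Unit using (⊤; tt)
open import Data.Vec using (Vec; []; _∷_; lookup)
import Data.Vec as Vec
import Data.Vec.Properties as Vec
open import Data.Vec.Relation.Binary.Pointwise.Inductive using (Pointwise; []; _∷_)
import Data.Vec.Relation.Binary.Pointwise.Inductive as Pointwise
open import Function using (_∘_; id; _⇔_; mk⇔; Equivalence)
open import Relation.Binary.PropositionalEquality using (_≡_; _≢_; refl; sym; trans; cong; cong₂; subst; subst₂; setoid)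
open import Relation.Nullary using (¬_; yes; no)
open import Relation.Nullary.Decidable using (dec-true; dec-false)
open import Data.List.Membership.DecPropositional (List.≡-dec ℕ._≟_) using () renaming (_∈?_ to _∈F?_)

-- Permutations and standard fillings

-- The spaces 𝐏_D have unrelated index sets `Fin (dim D)`, so identities between shapes are checked
-- on fillings, which all shapes share, and the extension by zero has to be controlled. Extending
-- π_i v by zero agrees with precomposing the extension of v with sorting only if a filling whose
-- sorted form is standard was itself standard (`SortReflects`). For ∂ to commute with π_i, a
-- filling standard for α⃗(J) whose sorted form is standard for some α⃗(I) must have a sorted form
-- standard for α⃗(J) too (`sort-standard`). Both rest on the fact that exchanging i and i+1
-- reverses the order of no other pair of entries. The contraction is chosen filling by filling and
-- need not be equivariant; acyclicity only concerns the underlying vector spaces.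

lookup-injective : ∀ {a} {A : Set a} {xs : List A} → Unique xs → ∀ i j → Data.List.lookup xs i ≡ Data.List.lookup xs j → i ≡ j
lookup-injective {xs = _ ∷ _} _ zero zero _ = refl
lookup-injective {xs = _ ∷ xs} (x∉ ∷ _) zero (suc j) eq = ⊥-elim (All.lookup x∉ (∈.∈-lookup {xs = xs} j) eq)
lookup-injective {xs = _ ∷ xs} (x∉ ∷ _) (suc i) zero eq = ⊥-elim (All.lookup x∉ (∈.∈-lookup {xs = xs} i) (sym eq))
lookup-injective {xs = _ ∷ _} (_ ∷ u) (suc i) (suc j) eq = cong suc (lookup-injective u i j eq)

∈-insertions⇒↭ : ∀ x ys {T} → T ∈ insertions x ys → T ↭ x ∷ ys
∈-insertions⇒↭ x [] (here refl) = ↭-refl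
∈-insertions⇒↭ x (y ∷ ys) (here refl) = ↭-refl
∈-insertions⇒↭ x (y ∷ ys) (there T∈) with _ , T′∈ , refl ← ∈.∈-map⁻ (y ∷_) T∈ =
  ↭-trans (prep y (∈-insertions⇒↭ x ys T′∈)) (swap y x ↭-refl)

∈-perms⇒↭ : ∀ xs {T} → T ∈ perms xs → T ↭ xs
∈-perms⇒↭ [] (here refl) = ↭-refl
∈-perms⇒↭ (x ∷ xs) T∈ with ys , ys∈ , T∈′ ← find (∈.∈-concatMap⁻ (insertions x) {xs = perms xs} T∈) =
  ↭-trans (∈-insertions⇒↭ x ys T∈′) (prep x (∈-perms⇒↭ xs ys∈))

∈-insertions : ∀ x ys zs → ys ++ x ∷ zs ∈ insertions x (ys ++ zs)
∈-insertions x [] [] = here refl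
∈-insertions x [] (z ∷ zs) = here refl
∈-insertions x (y ∷ ys) zs = there (∈.∈-map⁺ (y ∷_) (∈-insertions x ys zs))

↭⇒∈-perms : ∀ xs {T} → T ↭ xs → T ∈ perms xs
↭⇒∈-perms [] T↭ rewrite ↭.↭-empty-inv T↭ = here refl
↭⇒∈-perms (x ∷ xs) T↭ with ys , zs , refl ← ∈.∈-∃++ (↭.∈-resp-↭ (↭-sym T↭) (here refl)) =
  ∈.∈-concatMap⁺ (insertions x) (lose (↭⇒∈-perms xs (↭.drop-mid ys [] T↭)) (∈-insertions x ys zs))

-- A left inverse of inserting `x`, at any position, into a list without `x`. It makes the
-- insertions into two distinct lists disjoint, which `perms-unique` needs.
remove : ℕ → List ℕ → List ℕ
remove x [] = []
remove x (t ∷ T) = if t ≡ᵇ x then T else t ∷ remove x T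

≡ᵇ-refl : ∀ x → (x ≡ᵇ x) ≡ true
≡ᵇ-refl x = Equivalence.to 𝔹.T-≡ (ℕ.≡⇒≡ᵇ x x refl)

≢⇒≡ᵇ : ∀ {x y} → x ≢ y → (x ≡ᵇ y) ≡ false
≢⇒≡ᵇ {x} {y} x≢y with x ≡ᵇ y in eq
... | false = refl
... | true = ⊥-elim (x≢y (ℕ.≡ᵇ⇒≡ x y (Equivalence.from 𝔹.T-≡ eq)))

remove-insertion : ∀ x ys {T} → x ∉ ys → T ∈ insertions x ys → remove x T ≡ ys
remove-insertion x [] _ (here refl) rewrite ≡ᵇ-refl x = refl
remove-insertion x (y ∷ ys) _ (here refl) rewrite ≡ᵇ-refl x = refl
remove-insertion x (y ∷ ys) x∉ (there T∈) with _ , T′∈ , refl ← ∈.∈-map⁻ (y ∷_) T∈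
  rewrite ≢⇒≡ᵇ {y} {x} (x∉ ∘ here ∘ sym) = cong (y ∷_) (remove-insertion x ys (x∉ ∘ there) T′∈)

-- Only the insertion in front starts with `x`; all the others start with `y`, which differs from
-- `x`.
insertions-unique : ∀ x ys → x ∉ ys → Unique (insertions x ys)
insertions-unique x [] _ = [] ∷ []
insertions-unique x (y ∷ ys) x∉ =
  All.tabulate (λ T∈ eq → x∉ (here (trans (cong (head x) eq) (head-≡ (∈.∈-map⁻ (y ∷_) T∈)))))
  ∷ Unique.map⁺ List.∷-injectiveʳ (insertions-unique x ys (x∉ ∘ there))
  where
  head : ℕ → List ℕ → ℕ
  head d [] = d
  head _ (t ∷ _) = t
  head-≡ : ∀ {T} → (∃ λ T′ → T′ ∈ insertions x ys × T ≡ y ∷ T′) → head x T ≡ y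
  head-≡ (_ , _ , refl) = refl

Unique-resp-↭ : ∀ {a} {A : Set a} {xs ys : List A} → xs ↭ ys → Unique xs → Unique ys
Unique-resp-↭ xs↭ys = ↭ₛ.Unique-resp-↭ (setoid _) (↭⇒↭ₛ xs↭ys)

perms-unique : ∀ {xs} → Unique xs → Unique (perms xs)
perms-unique {[]} _ = [] ∷ []
perms-unique {x ∷ xs} u@(_ ∷ u′) = Unique.concat⁺
  (All.map⁺ (All.tabulate λ {ys} ys∈ → insertions-unique x ys (x∉ ys∈)))
  (AllPairs.map⁺ (go (All.tabulate id) (perms-unique u′)))
  where
  x∉ : ∀ {ys} → ys ∈ perms xs → x ∉ ys
  x∉ ys∈ x∈ = Unique.Unique[x∷xs]⇒x∉xs u (↭.∈-resp-↭ (∈-perms⇒↭ xs ys∈) x∈)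
  go : ∀ {yss} → All (_∈ perms xs) yss → Unique yss → AllPairs (λ ys zs → Disjoint (insertions x ys) (insertions x zs)) yss
  go [] [] = []
  go (p ∷ ps) (u ∷ us) = All.map (λ { {zs} (zs∈ , ≢) (T∈ , T∈′) →
    ≢ (trans (sym (remove-insertion x _ (x∉ p) T∈)) (remove-insertion x zs (x∉ zs∈) T∈′)) }) (All.zip (ps , u)) ∷ go ps us

oneTo-unique : ∀ n → Unique (oneTo n)
oneTo-unique n = Unique.map⁺ ℕ.suc-injective (Unique.upTo⁺ n)

∈-oneTo⁺ : ∀ {n i} → 1 ≤ i → i ≤ n → i ∈ oneTo n
∈-oneTo⁺ {i = suc i} _ i≤n = ∈.∈-map⁺ suc (∈.∈-upTo⁺ i≤n)

length-oneTo : ∀ n → length (oneTo n) ≡ n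
length-oneTo n = trans (List.length-map suc (upTo n)) (List.length-upTo n)

sw : ℕ → ℕ → ℕ
sw i t = if t ≡ᵇ i then suc i else (if t ≡ᵇ suc i then i else t)

data SwapCase (i t : ℕ) : Set where
  lower : t ≡ i → sw i t ≡ suc i → SwapCase i t
  upper : t ≡ suc i → sw i t ≡ i → SwapCase i t
  other : t ≢ i → t ≢ suc i → sw i t ≡ t → SwapCase i t

sw-lower : ∀ i → sw i i ≡ suc i
sw-lower i rewrite ≡ᵇ-refl i = refl

sw-upper : ∀ i → sw i (suc i) ≡ i
sw-upper i rewrite ≢⇒≡ᵇ (ℕ.1+n≢n {i}) | ≡ᵇ-refl i = refl

sw-other : ∀ {i t} → t ≢ i → t ≢ suc i → sw i t ≡ t
sw-other t≢i t≢si rewrite ≢⇒≡ᵇ t≢i | ≢⇒≡ᵇ t≢si = refl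

swapCase : ∀ i t → SwapCase i t
swapCase i t with t ℕ.≟ i
... | yes refl = lower refl (sw-lower i)
... | no t≢i with t ℕ.≟ suc i
...   | yes refl = upper refl (sw-upper i)
...   | no t≢si = other t≢i t≢si (sw-other t≢i t≢si)

sw-involutive : ∀ i t → sw i (sw i t) ≡ t
sw-involutive i t with swapCase i t
... | lower refl eq rewrite eq = sw-upper i
... | upper refl eq rewrite eq = sw-lower i
... | other _ _ eq rewrite eq = eq

sw-injective : ∀ i {t u} → sw i t ≡ sw i u → t ≡ u
sw-injective i {t} {u} eq = trans (sym (sw-involutive i t)) (trans (cong (sw i) eq) (sw-involutive i u))

swapEntries-involutive : ∀ i T → swapEntries i (swapEntries i T) ≡ T
swapEntries-involutive i T = trans (sym (List.map-∘ T)) (trans (List.map-cong (sw-involutive i) T) (List.map-id T))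

-- Since 1 ≤ i < n, `sw i` is an involution of {1,...,n}; two repetition-free lists with the same
-- members are permutations of each other.
swapEntries-↭ : ∀ {n i} → 1 ≤ i → i < n → ∀ {T} → T ↭ oneTo n → swapEntries i T ↭ oneTo n
swapEntries-↭ {n} {i} 1≤i i<n T↭ = ↭-trans (↭.map⁺ (sw i) T↭)
  (∼bag⇒↭ (unique∧set⇒bag (Unique.map⁺ (sw-injective i) (oneTo-unique n)) (oneTo-unique n) (mk⇔ to from)))
  where
  sw∈ : ∀ {t} → t ∈ oneTo n → sw i t ∈ oneTo n
  sw∈ {t} t∈ with swapCase i t
  ... | lower refl eq rewrite eq = ∈-oneTo⁺ (s≤s z≤n) i<n
  ... | upper refl eq rewrite eq = ∈-oneTo⁺ 1≤i (ℕ.<⇒≤ i<n)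
  ... | other _ _ eq rewrite eq = t∈
  to : ∀ {t} → t ∈ map (sw i) (oneTo n) → t ∈ oneTo n
  to t∈ with u , u∈ , refl ← ∈.∈-map⁻ (sw i) t∈ = sw∈ u∈
  from : ∀ {t} → t ∈ oneTo n → t ∈ map (sw i) (oneTo n)
  from {t} t∈ = subst (_∈ map (sw i) (oneTo n)) (sw-involutive i t) (∈.∈-map⁺ (sw i) (sw∈ t∈))

∈-syt⁺ : ∀ D {U} → U ↭ oneTo (length D) → T (isStandardᵇ D U) → U ∈ syt D
∈-syt⁺ D U↭ std = ∈.∈-filter⁺ (λ U → 𝔹.T? (isStandardᵇ D U)) (↭⇒∈-perms _ U↭) std

∈-syt⁻ : ∀ D {U} → U ∈ syt D → U ↭ oneTo (length D) × T (isStandardᵇ D U)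
∈-syt⁻ D U∈ with U∈′ , std ← ∈.∈-filter⁻ (λ U → 𝔹.T? (isStandardᵇ D U)) {xs = perms (oneTo (length D))} U∈ = ∈-perms⇒↭ _ U∈′ , std

syt-unique : ∀ D → Unique (syt D)
syt-unique D = Unique.filter⁺ (λ U → 𝔹.T? (isStandardᵇ D U)) (perms-unique (oneTo-unique (length D)))

tab-injective : ∀ D t t′ → tab D t ≡ tab D t′ → t ≡ t′
tab-injective D = lookup-injective (syt-unique D)

-- Sorting i and i+1 by rows

<⇒<ᵇ≡true : ∀ {x y} → x < y → (x <ᵇ y) ≡ true
<⇒<ᵇ≡true x<y = Equivalence.to 𝔹.T-≡ (ℕ.<⇒<ᵇ x<y)

≮⇒<ᵇ≡false : ∀ {x y} → ¬ x < y → (x <ᵇ y) ≡ false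
≮⇒<ᵇ≡false {x} {y} x≮y with x <ᵇ y in eq
... | false = refl
... | true = ⊥-elim (x≮y (ℕ.<ᵇ⇒< x y (Equivalence.from 𝔹.T-≡ eq)))

sw-≡ᵇ : ∀ i t e → (sw i t ≡ᵇ e) ≡ (t ≡ᵇ sw i e)
sw-≡ᵇ i t e with sw i t ℕ.≟ e
... | yes refl = trans (≡ᵇ-refl (sw i t)) (sym (trans (cong (t ≡ᵇ_) (sw-involutive i t)) (≡ᵇ-refl t)))
... | no ≢ = trans (≢⇒≡ᵇ {sw i t} {e} ≢) (sym (≢⇒≡ᵇ {t} {sw i e} λ eq → ≢ (trans (cong (sw i) eq) (sw-involutive i e))))

rowOf-swapEntries : ∀ D i T e → rowOf D (swapEntries i T) e ≡ rowOf D T (sw i e)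
rowOf-swapEntries [] i T e = refl
rowOf-swapEntries (_ ∷ D) i [] e = refl
rowOf-swapEntries ((x , y) ∷ D) i (t ∷ T) e rewrite sw-≡ᵇ i t e | rowOf-swapEntries D i T e = refl

-- The transpose of π_i. If i lies higher than i+1 in T, then π_i T = 0 and s_i(T) is the one
-- tableau whose image contains T; otherwise T itself is the only one. So the coefficient of π_i v
-- at T is that of v at the sorted filling.
sortEntries : List Cell → ℕ → Filling → Filling
sortEntries D i T = if rowOf D T (suc i) <ᵇ rowOf D T i then swapEntries i T else T

module _ (D : List Cell) where

  sortEntries-swap : ∀ {i T} → rowOf D T (suc i) < rowOf D T i → sortEntries D i T ≡ swapEntries i T
  sortEntries-swap lt rewrite <⇒<ᵇ≡true lt = refl

  sortEntries-keep : ∀ {i T} → ¬ rowOf D T (suc i) < rowOf D T i → sortEntries D i T ≡ T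
  sortEntries-keep ≮ rewrite ≮⇒<ᵇ≡false ≮ = refl

  rowOf-swap-lower : ∀ i T → rowOf D (swapEntries i T) i ≡ rowOf D T (suc i)
  rowOf-swap-lower i T = trans (rowOf-swapEntries D i T i) (cong (rowOf D T) (sw-lower i))

  rowOf-swap-upper : ∀ i T → rowOf D (swapEntries i T) (suc i) ≡ rowOf D T i
  rowOf-swap-upper i T = trans (rowOf-swapEntries D i T (suc i)) (cong (rowOf D T) (sw-upper i))

  rowOf-swap-other : ∀ i T {e} → e ≢ i → e ≢ suc i → rowOf D (swapEntries i T) e ≡ rowOf D T e
  rowOf-swap-other i T e≢i e≢si = trans (rowOf-swapEntries D i T _) (cong (rowOf D T) (sw-other e≢i e≢si))

  sortEntries-idem : ∀ i T → sortEntries D i (sortEntries D i T) ≡ sortEntries D i T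
  sortEntries-idem i T with rowOf D T (suc i) ℕ.<? rowOf D T i
  ... | no ≮ rewrite sortEntries-keep ≮ = sortEntries-keep ≮
  ... | yes lt rewrite sortEntries-swap lt = sortEntries-keep λ lt′ →
    ℕ.<-asym lt (subst₂ _<_ (rowOf-swap-upper i T) (rowOf-swap-lower i T) lt′)

  rowOf-sortEntries-other : ∀ i T {e} → e ≢ i → e ≢ suc i → rowOf D (sortEntries D i T) e ≡ rowOf D T e
  rowOf-sortEntries-other i T e≢i e≢si with rowOf D T (suc i) <ᵇ rowOf D T i
  ... | true = rowOf-swap-other i T e≢i e≢si
  ... | false = refl

  swapEntries-comm : ∀ i j T → i ≢ j → i ≢ suc j → suc i ≢ j →
    swapEntries i (swapEntries j T) ≡ swapEntries j (swapEntries i T)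
  swapEntries-comm i j T i≢j i≢sj si≢j =
    trans (sym (List.map-∘ T)) (trans (List.map-cong go T) (List.map-∘ T))
    where
    both : ∀ t {u v w} → sw j t ≡ u → sw i u ≡ w → sw i t ≡ v → sw j v ≡ w → sw i (sw j t) ≡ sw j (sw i t)
    both _ refl refl refl eq = sym eq
    go : ∀ t → sw i (sw j t) ≡ sw j (sw i t)
    go t with swapCase i t | swapCase j t
    ... | lower refl _ | lower refl _ = ⊥-elim (i≢j refl)
    ... | lower refl _ | upper refl _ = ⊥-elim (i≢sj refl)
    ... | upper refl _ | lower refl _ = ⊥-elim (si≢j refl)
    ... | upper refl _ | upper refl _ = ⊥-elim (i≢j refl)
    ... | lower refl eq | other _ _ eq′ = both t eq′ eq eq (sw-other si≢j (i≢j ∘ ℕ.suc-injective))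
    ... | upper refl eq | other _ _ eq′ = both t eq′ eq eq (sw-other i≢j i≢sj)
    ... | other _ _ eq | lower refl eq′ = both t eq′ (sw-other (i≢sj ∘ sym) (i≢j ∘ sym ∘ ℕ.suc-injective)) eq eq′
    ... | other _ _ eq | upper refl eq′ = both t eq′ (sw-other (i≢j ∘ sym) (si≢j ∘ sym)) eq eq′
    ... | other _ _ eq | other _ _ eq′ = both t eq′ eq eq eq′

  sortEntries-comm : ∀ i j T → i ≢ j → i ≢ suc j → suc i ≢ j →
    sortEntries D i (sortEntries D j T) ≡ sortEntries D j (sortEntries D i T)
  sortEntries-comm i j T i≢j i≢sj si≢j
    rewrite rowOf-sortEntries-other j T i≢j i≢sj
          | rowOf-sortEntries-other j T si≢j (i≢j ∘ ℕ.suc-injective)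
          | rowOf-sortEntries-other i T (i≢j ∘ sym) (si≢j ∘ sym)
          | rowOf-sortEntries-other i T (i≢sj ∘ sym) (i≢j ∘ sym ∘ ℕ.suc-injective)
    with rowOf D T (suc i) <ᵇ rowOf D T i | rowOf D T (suc j) <ᵇ rowOf D T j
  ... | true | true = swapEntries-comm i j T i≢j i≢sj si≢j
  ... | true | false = refl
  ... | false | true = refl
  ... | false | false = refl

  module _ (i : ℕ) where
    private
      s₁ s₂ p₁ p₂ : Filling → Filling
      s₁ = swapEntries i
      s₂ = swapEntries (suc i)
      p₁ = sortEntries D i
      p₂ = sortEntries D (suc i)

    Rows : Filling → ℕ → ℕ → ℕ → Set
    Rows T a b c = rowOf D T i ≡ a × rowOf D T (suc i) ≡ b × rowOf D T (suc (suc i)) ≡ c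

    private
      i≢2+i : i ≢ suc (suc i)
      i≢2+i = ℕ.m≢1+n+m i {1}

      swap₁ : ∀ {T a b c} → Rows T a b c → b < a → p₁ T ≡ s₁ T
      swap₁ (refl , refl , _) lt = sortEntries-swap lt
      swap₂ : ∀ {T a b c} → Rows T a b c → c < b → p₂ T ≡ s₂ T
      swap₂ (_ , refl , refl) lt = sortEntries-swap lt
      keep₁ : ∀ {T a b c} → Rows T a b c → ¬ b < a → p₁ T ≡ T
      keep₁ (refl , refl , _) ≮ = sortEntries-keep ≮
      keep₂ : ∀ {T a b c} → Rows T a b c → ¬ c < b → p₂ T ≡ T
      keep₂ (_ , refl , refl) ≮ = sortEntries-keep ≮
      rows₁ : ∀ {T a b c} → Rows T a b c → Rows (s₁ T) b a c
      rows₁ {T} (refl , refl , refl) = rowOf-swap-lower i T , rowOf-swap-upper i T , rowOf-swap-other i T (i≢2+i ∘ sym) ℕ.1+n≢n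
      rows₂ : ∀ {T a b c} → Rows T a b c → Rows (s₂ T) a c b
      rows₂ {T} (refl , refl , refl) = rowOf-swap-other (suc i) T (ℕ.1+n≢n ∘ sym) i≢2+i , rowOf-swap-lower (suc i) T , rowOf-swap-upper (suc i) T

      both : ∀ t {u v w u′ v′} → sw i t ≡ u → sw (suc i) u ≡ v → sw i v ≡ w →
        sw (suc i) t ≡ u′ → sw i u′ ≡ v′ → sw (suc i) v′ ≡ w →
        sw i (sw (suc i) (sw i t)) ≡ sw (suc i) (sw i (sw (suc i) t))
      both _ refl refl refl refl refl eq = sym eq

      sw-braid : ∀ t → sw i (sw (suc i) (sw i t)) ≡ sw (suc i) (sw i (sw (suc i) t))
      sw-braid t with swapCase i t | swapCase (suc i) t
      ... | lower eq _ | lower eq′ _ = ⊥-elim (ℕ.1+n≢n (trans (sym eq′) eq))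
      ... | lower eq _ | upper eq′ _ = ⊥-elim (i≢2+i (trans (sym eq) eq′))
      ... | lower refl eq | other _ _ eq′ = both t eq (sw-lower (suc i)) (sw-other (i≢2+i ∘ sym) ℕ.1+n≢n) eq′ eq (sw-lower (suc i))
      ... | upper eq _ | upper eq′ _ = ⊥-elim (ℕ.1+n≢n (trans (sym eq′) eq))
      ... | upper refl _ | other ≢ _ _ = ⊥-elim (≢ refl)
      ... | upper refl eq | lower _ eq′ = both t eq (sw-other (ℕ.1+n≢n ∘ sym) i≢2+i) (sw-lower i) eq′ (sw-other (i≢2+i ∘ sym) ℕ.1+n≢n) (sw-upper (suc i))
      ... | other _ ≢ _ | lower eq _ = ⊥-elim (≢ eq)
      ... | other _ _ eq | upper refl eq′ = both t eq eq′ (sw-upper i) eq′ (sw-upper i) (sw-other (ℕ.1+n≢n ∘ sym) i≢2+i)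
      ... | other _ _ eq | other _ _ eq′ = both t eq eq′ eq eq′ eq eq′

    swapEntries-braid : ∀ T → s₁ (s₂ (s₁ T)) ≡ s₂ (s₁ (s₂ T))
    swapEntries-braid T = trans (fuse (sw i) (sw (suc i)) (sw i)) (trans (List.map-cong sw-braid T) (sym (fuse (sw (suc i)) (sw i) (sw (suc i)))))
      where
      fuse : ∀ (f g h : ℕ → ℕ) → map f (map g (map h T)) ≡ map (f ∘ g ∘ h) T
      fuse f g h = trans (sym (List.map-∘ _)) (sym (List.map-∘ T))

    -- Only the rows a, b, c of i, i+1, i+2 decide which swaps happen, and a swap permutes this
    -- triple. Both sides bubble-sort it; they perform the same swaps except when a > b > c, where
    -- the braid relation of the transpositions is used.
    sortEntries-braid : ∀ T → p₁ (p₂ (p₁ T)) ≡ p₂ (p₁ (p₂ T))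
    sortEntries-braid T = go (rowOf D T i) (rowOf D T (suc i)) (rowOf D T (suc (suc i))) (refl , refl , refl)
      where
      go : ∀ a b c → Rows T a b c → p₁ (p₂ (p₁ T)) ≡ p₂ (p₁ (p₂ T))
      go a b c r with b ℕ.<? a | c ℕ.<? b | c ℕ.<? a
      ... | no ba | no cb | _
        rewrite keep₁ r ba | keep₂ r cb | keep₁ r ba | keep₂ r cb = refl
      ... | yes ba | yes cb | no ca = ⊥-elim (ca (ℕ.<-trans cb ba))
      ... | yes ba | no cb | no ca
        rewrite swap₁ r ba | keep₂ (rows₁ r) ca | keep₁ (rows₁ r) (ℕ.<-asym ba)
              | keep₂ r cb | swap₁ r ba | keep₂ (rows₁ r) ca = refl
      ... | yes ba | no cb | yes ca
        rewrite swap₁ r ba | swap₂ (rows₁ r) ca | keep₁ (rows₂ (rows₁ r)) cb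
              | keep₂ r cb | swap₁ r ba | swap₂ (rows₁ r) ca = refl
      ... | no ba | yes cb | yes ca
        rewrite keep₁ r ba | swap₂ r cb | swap₁ (rows₂ r) ca | keep₂ (rows₁ (rows₂ r)) ba = refl
      ... | no ba | yes cb | no ca
        rewrite keep₁ r ba | swap₂ r cb | keep₁ (rows₂ r) ca | keep₂ (rows₂ r) (ℕ.<-asym cb) = refl
      ... | yes ba | yes cb | yes ca
        rewrite swap₁ r ba | swap₂ (rows₁ r) ca | swap₁ (rows₂ (rows₁ r)) cb
              | swap₂ r cb | swap₁ (rows₂ r) ca | swap₂ (rows₁ (rows₂ r)) ba = swapEntries-braid T

-- Diagrams of step words

-- A generalized ribbon is a lattice path from its southwest end: each step leads to the box on the
-- right, to the box above, or diagonally into the next component.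
data Step : Set where
  asc desc free : Step

Ok : Step → ℕ → ℕ → Set
Ok asc t t′ = t < t′
Ok desc t t′ = t′ < t
Ok free t t′ = ⊤

right up : Step → ℕ → ℕ
right desc x = x
right _ x = suc x
up asc y = y
up _ y = suc y

moves : ℕ → ℕ → List Step → List Cell
moves x y [] = []
moves x y (s ∷ w) = (right s x , up s y) ∷ moves (right s x) (up s y) w

cells : ℕ → ℕ → List Step → List Cell
cells x y w = (x , y) ∷ moves x y w

data Steps (Q : Step → ℕ → ℕ → Set) : List Step → List ℕ → Set where
  [-] : ∀ {t} → Steps Q [] (t ∷ [])
  _∷_ : ∀ {s t t′ w T} → Q s t t′ → Steps Q w (t′ ∷ T) → Steps Q (s ∷ w) (t ∷ t′ ∷ T)

Steps-map : ∀ {Q R w T} → (∀ {s a b} → Q s a b → R s a b) → Steps Q w T → Steps R w T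
Steps-map f [-] = [-]
Steps-map f (q ∷ qs) = f q ∷ Steps-map f qs

Steps-zip : ∀ {Q R w T} → Steps Q w T → Steps R w T → Steps (λ s a b → Q s a b × R s a b) w T
Steps-zip [-] [-] = [-]
Steps-zip (q ∷ qs) (r ∷ rs) = (q , r) ∷ Steps-zip qs rs

Steps-mapEntries : ∀ {Q w T} (f : ℕ → ℕ) → Steps (λ s a b → Q s (f a) (f b)) w T → Steps Q w (map f T)
Steps-mapEntries f [-] = [-]
Steps-mapEntries f (q ∷ qs) = q ∷ Steps-mapEntries f qs

T-guard : ∀ {a b c d} e → T (if (a ≡ᵇ b) ∧ (c ≡ᵇ d) then e else true) ⇔ (a ≡ b → c ≡ d → T e)
T-guard {a} {b} {c} {d} e = mk⇔ to from
  where
  to : T (if (a ≡ᵇ b) ∧ (c ≡ᵇ d) then e else true) → a ≡ b → c ≡ d → T e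
  to h refl refl rewrite ≡ᵇ-refl a | ≡ᵇ-refl c = h
  from : (a ≡ b → c ≡ d → T e) → T (if (a ≡ᵇ b) ∧ (c ≡ᵇ d) then e else true)
  from h with a ≡ᵇ b in eq | c ≡ᵇ d in eq′
  ... | true | true = h (ℕ.≡ᵇ⇒≡ a b (Equivalence.from 𝔹.T-≡ eq)) (ℕ.≡ᵇ⇒≡ c d (Equivalence.from 𝔹.T-≡ eq′))
  ... | true | false = tt
  ... | false | _ = tt

OkPair : Cell × ℕ → Cell × ℕ → Set
OkPair ((x , y) , e) ((x′ , y′) , e′) =
  (y ≡ y′ → suc x ≡ x′ → e < e′) × (x ≡ x′ → y ≡ suc y′ → e < e′)

OkPair⁺ : ∀ p q → OkPair p q → T (okPair p q)
OkPair⁺ ((x , y) , e) ((x′ , y′) , e′) (h , v) = Equivalence.from 𝔹.T-∧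
  (Equivalence.from (T-guard {y} {y′} {suc x} {x′} _) (λ eq eq′ → ℕ.<⇒<ᵇ (h eq eq′)) ,
   Equivalence.from (T-guard {x} {x′} {y} {suc y′} _) (λ eq eq′ → ℕ.<⇒<ᵇ (v eq eq′)))

OkPair⁻ : ∀ p q → T (okPair p q) → OkPair p q
OkPair⁻ ((x , y) , e) ((x′ , y′) , e′) h with h₁ , h₂ ← Equivalence.to 𝔹.T-∧ h =
  (λ eq eq′ → ℕ.<ᵇ⇒< e e′ (Equivalence.to (T-guard {y} {y′} {suc x} {x′} _) h₁ eq eq′)) ,
  (λ eq eq′ → ℕ.<ᵇ⇒< e e′ (Equivalence.to (T-guard {x} {x′} {y} {suc y′} _) h₂ eq eq′))

isStandard⁺ : ∀ D U → (∀ {p q} → p ∈ zip D U → q ∈ zip D U → OkPair p q) → T (isStandardᵇ D U)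
isStandard⁺ D U h = All.all⁻ _ (All.tabulate λ {p} p∈ → All.all⁻ _ (All.tabulate λ {q} q∈ → OkPair⁺ p q (h p∈ q∈)))

isStandard⁻ : ∀ D U → T (isStandardᵇ D U) → ∀ {p q} → p ∈ zip D U → q ∈ zip D U → OkPair p q
isStandard⁻ D U std {p} {q} p∈ q∈ = OkPair⁻ p q (All.lookup (All.all⁺ _ _ (All.lookup (All.all⁺ _ _ std) p∈)) q∈)

OkPair-steps : ∀ x y w U → length U ≡ suc (length w) →
  (∀ {p q} → p ∈ zip (cells x y w) U → q ∈ zip (cells x y w) U → OkPair p q) → Steps Ok w U
OkPair-steps x y [] (t ∷ []) _ _ = [-]
OkPair-steps x y (s ∷ w) (t ∷ t′ ∷ U) len h =
  ok s (h (here refl) (there (here refl))) (h (there (here refl)) (here refl)) ∷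
  OkPair-steps (right s x) (up s y) w (t′ ∷ U) (ℕ.suc-injective len) (λ p∈ q∈ → h (there p∈) (there q∈))
  where
  ok : ∀ s → OkPair ((x , y) , t) ((right s x , up s y) , t′) → OkPair ((right s x , up s y) , t′) ((x , y) , t) → Ok s t t′
  ok asc (h , _) _ = h refl refl
  ok desc _ (_ , v) = v refl refl
  ok free _ _ = tt

right-≤ : ∀ s x → x ≤ right s x
right-≤ asc x = ℕ.n≤1+n x
right-≤ desc x = ℕ.≤-refl
right-≤ free x = ℕ.n≤1+n x

up-≤ : ∀ s y → y ≤ up s y
up-≤ asc y = ℕ.≤-refl
up-≤ desc y = ℕ.n≤1+n y
up-≤ free y = ℕ.n≤1+n y

step-< : ∀ s x y → suc (x ℕ.+ y) ≤ right s x ℕ.+ up s y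
step-< asc x y = ℕ.≤-refl
step-< desc x y = ℕ.≤-reflexive (sym (ℕ.+-suc x y))
step-< free x y = s≤s (ℕ.+-monoʳ-≤ x (ℕ.n≤1+n y))

-- Adjacent cells differ by one in the coordinate sum, so cells two or more steps apart are unconstrained.
Beyond : ℕ → ℕ → Cell × ℕ → Set
Beyond x y ((x′ , y′) , _) = x ≤ x′ × y ≤ y′ × suc (x ℕ.+ y) < x′ ℕ.+ y′

beyond : ∀ {x y} x₀ y₀ w U → x ≤ x₀ → y ≤ y₀ → x ℕ.+ y < x₀ ℕ.+ y₀ → All (Beyond x y) (zip (moves x₀ y₀ w) U)
beyond x₀ y₀ [] U _ _ _ = []
beyond x₀ y₀ (s ∷ w) [] _ _ _ = []
beyond x₀ y₀ (s ∷ w) (t ∷ U) x≤ y≤ lt =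
  (x≤′ , y≤′ , lt′) ∷ beyond (right s x₀) (up s y₀) w U x≤′ y≤′ (ℕ.≤-trans (ℕ.n≤1+n _) lt′)
  where
  x≤′ = ℕ.≤-trans x≤ (right-≤ s x₀)
  y≤′ = ℕ.≤-trans y≤ (up-≤ s y₀)
  lt′ = ℕ.≤-trans (s≤s lt) (step-< s x₀ y₀)

Compatible : Cell × ℕ → Cell × ℕ → Set
Compatible p q = OkPair p q × OkPair q p

beyond⇒compatible : ∀ {x y t} q → Beyond x y q → Compatible ((x , y) , t) q
beyond⇒compatible {x} {y} ((x′ , y′) , _) (x≤ , y≤ , lt) =
  ((λ { refl refl → ⊥-elim (ℕ.<-irrefl refl lt) }) ,
   (λ { refl refl → ⊥-elim (ℕ.1+n≰n y≤) })) ,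
  ((λ { refl refl → ⊥-elim (ℕ.1+n≰n x≤) }) ,
   (λ { refl refl → ⊥-elim (ℕ.<-irrefl (sym (ℕ.+-suc x y)) lt) }))

steps-compatible : ∀ x y {w U} → Steps Ok w U → AllPairs Compatible (zip (cells x y w) U)
steps-compatible x y [-] = [] ∷ []
steps-compatible x y (_∷_ {s} {t} {t′} {w} {U} ok oks) =
  (next s ok ∷ All.map (λ {q} → beyond⇒compatible q)
    (beyond (right s x) (up s y) w U (right-≤ s x) (up-≤ s y) (step-< s x y)))
  ∷ steps-compatible (right s x) (up s y) oks
  where
  next : ∀ s → Ok s t t′ → Compatible ((x , y) , t) ((right s x , up s y) , t′)
  next asc lt = ((λ _ _ → lt) , λ eq → ⊥-elim (ℕ.1+n≢n (sym eq))) ,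
    ((λ _ eq → ⊥-elim (ℕ.m≢1+n+m x {1} (sym eq))) , λ eq → ⊥-elim (ℕ.1+n≢n eq))
  next desc lt = ((λ eq → ⊥-elim (ℕ.1+n≢n (sym eq))) , λ _ eq → ⊥-elim (ℕ.m≢1+n+m y {1} eq)) ,
    ((λ eq → ⊥-elim (ℕ.1+n≢n eq)) , λ _ _ → lt)
  next free _ = ((λ eq → ⊥-elim (ℕ.1+n≢n (sym eq))) , λ eq → ⊥-elim (ℕ.1+n≢n (sym eq))) ,
    ((λ eq → ⊥-elim (ℕ.1+n≢n eq)) , λ eq → ⊥-elim (ℕ.1+n≢n eq))

AllPairs-∈ : ∀ {c r} {A : Set c} {R : A → A → Set r} {xs} → AllPairs (λ p q → R p q × R q p) xs → (∀ p → R p p) →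
  ∀ {p q} → p ∈ xs → q ∈ xs → R p q
AllPairs-∈ (_ ∷ _) r (here refl) (here refl) = r _
AllPairs-∈ (h ∷ _) r (here refl) (there q∈) = proj₁ (All.lookup h q∈)
AllPairs-∈ (h ∷ _) r (there p∈) (here refl) = proj₂ (All.lookup h p∈)
AllPairs-∈ (_ ∷ hs) r (there p∈) (there q∈) = AllPairs-∈ hs r p∈ q∈

length-moves : ∀ x y w → length (moves x y w) ≡ length w
length-moves x y [] = refl
length-moves x y (s ∷ w) = cong suc (length-moves _ _ w)

ribbonOf : List Step → List Cell
ribbonOf = cells 0 0

length-ribbonOf : ∀ w → length (ribbonOf w) ≡ suc (length w)
length-ribbonOf w = cong suc (length-moves 0 0 w)

∈-syt-ribbonOf⁺ : ∀ w {U} → U ↭ oneTo (suc (length w)) → Steps Ok w U → U ∈ syt (ribbonOf w)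
∈-syt-ribbonOf⁺ w {U} U↭ oks = ∈-syt⁺ (ribbonOf w) (subst (λ n → U ↭ oneTo n) (sym (length-ribbonOf w)) U↭)
  (isStandard⁺ (ribbonOf w) U (AllPairs-∈ {R = OkPair} (steps-compatible 0 0 oks) (λ _ → (λ _ eq → ⊥-elim (ℕ.1+n≢n eq)) , λ _ eq → ⊥-elim (ℕ.1+n≢n (sym eq)))))

∈-syt-ribbonOf⁻ : ∀ w {U} → U ∈ syt (ribbonOf w) → U ↭ oneTo (suc (length w)) × Steps Ok w U
∈-syt-ribbonOf⁻ w {U} U∈ with U↭ , std ← ∈-syt⁻ (ribbonOf w) U∈ =
  U↭′ , OkPair-steps 0 0 w U (trans (↭.↭-length U↭′) (length-oneTo _)) (isStandard⁻ (ribbonOf w) U std)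
  where U↭′ = subst (λ n → U ↭ oneTo n) (length-ribbonOf w) (proj₁ (∈-syt⁻ (ribbonOf w) U∈))

rowOf-head : ∀ x y D t U → rowOf ((x , y) ∷ D) (t ∷ U) t ≡ y
rowOf-head x y D t U rewrite ≡ᵇ-refl t = refl

rowOf-tail : ∀ {x y D t U e} → t ≢ e → rowOf ((x , y) ∷ D) (t ∷ U) e ≡ rowOf D U e
rowOf-tail t≢e rewrite ≢⇒≡ᵇ t≢e = refl

-- The row function `r` is a parameter kept through the recursion, so that the result speaks of rows
-- in the whole diagram and not in a tail. Distinct entries make the first match found by `rowOf`
-- the only one.
rowOf-steps : ∀ {Q} (r : ℕ → ℕ) x y {w U} → Unique U → Steps Q w U →
  (∀ {e} → e ∈ U → r e ≡ rowOf (cells x y w) U e) → Steps (λ s a b → r b ≡ up s (r a)) w U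
rowOf-steps r x y _ [-] _ = [-]
rowOf-steps r x y (t≢ ∷ u) (_∷_ {s} {t} {t′} {w} {U} _ qs) r≡ =
  trans (r≡tail (here refl)) (trans (rowOf-head (right s x) (up s y) (moves (right s x) (up s y) w) t′ U) (cong (up s) (sym (trans (r≡ (here refl)) (rowOf-head x y (moves x y (s ∷ w)) t (t′ ∷ U))))))
  ∷ rowOf-steps r (right s x) (up s y) u qs r≡tail
  where
  r≡tail : ∀ {e} → e ∈ t′ ∷ U → r e ≡ rowOf (cells (right s x) (up s y) w) (t′ ∷ U) e
  r≡tail e∈ = trans (r≡ (there e∈)) (rowOf-tail {x} {y} {cells (right s x) (up s y) w} {_} {t′ ∷ U} (All.lookup t≢ e∈))

-- Exchanging `i` and `i+1` in a standard word

sw-mono : ∀ {i a b} → a < b → ¬ (a ≡ i × b ≡ suc i) → sw i a < sw i b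
sw-mono {i} {a} {b} a<b ¬adj with swapCase i a | swapCase i b
... | lower refl _ | lower refl _ = ⊥-elim (ℕ.<-irrefl refl a<b)
... | lower refl _ | upper refl _ = ⊥-elim (¬adj (refl , refl))
... | lower refl eq | other _ ≢ eq′ = subst₂ _<_ (sym eq) (sym eq′) (ℕ.≤∧≢⇒< a<b (≢ ∘ sym))
... | upper refl _ | lower refl _ = ⊥-elim (ℕ.<-asym a<b (ℕ.n<1+n _))
... | upper refl _ | upper refl _ = ⊥-elim (ℕ.<-irrefl refl a<b)
... | upper refl eq | other _ _ eq′ = subst₂ _<_ (sym eq) (sym eq′) (ℕ.<-trans (ℕ.n<1+n _) a<b)
... | other _ _ eq | lower refl eq′ = subst₂ _<_ (sym eq) (sym eq′) (ℕ.<-trans a<b (ℕ.n<1+n _))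
... | other ≢ _ eq | upper refl eq′ = subst₂ _<_ (sym eq) (sym eq′) (ℕ.≤∧≢⇒< (ℕ.≤-pred a<b) ≢)
... | other _ _ eq | other _ _ eq′ = subst₂ _<_ (sym eq) (sym eq′) a<b

sw-mono-sameRow : ∀ {i a b} (r : ℕ → ℕ) → r i ≢ r (suc i) → r b ≡ r a → a < b → sw i a < sw i b
sw-mono-sameRow r ≢ eq a<b = sw-mono a<b λ { (refl , refl) → ≢ (sym eq) }

sw-mono-rowBelow : ∀ {i a b} (r : ℕ → ℕ) → r i ≤ r (suc i) → r b ≡ suc (r a) → b < a → sw i b < sw i a
sw-mono-rowBelow r ≤ eq b<a = sw-mono b<a λ { (refl , refl) → ℕ.1+n≰n (ℕ.≤-trans (ℕ.≤-reflexive (sym eq)) ≤) }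

-- A step can only break if its two entries are i and i+1. At `asc` they would share a row, at
-- `desc` the smaller one would be the higher one; both contradict i lying strictly below i+1.
swap-Ok : ∀ i w {U} → Unique U → Steps Ok w U →
  rowOf (ribbonOf w) U i < rowOf (ribbonOf w) U (suc i) → Steps Ok w (swapEntries i U)
swap-Ok i w {U} u oks lt = Steps-mapEntries (sw i)
  (Steps-map (λ {s} → step s) (Steps-zip oks (rowOf-steps r 0 0 u oks λ _ → refl)))
  where
  r = rowOf (ribbonOf w) U
  step : ∀ s {a b} → Ok s a b × r b ≡ up s (r a) → Ok s (sw i a) (sw i b)
  step asc (a<b , eq) = sw-mono-sameRow r (ℕ.<⇒≢ lt) eq a<b
  step desc (b<a , eq) = sw-mono-rowBelow r (ℕ.<⇒≤ lt) eq b<a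
  step free _ = tt

-- If sorting made a swap, then i lies strictly below i+1 afterwards, and swapping back preserves
-- standardness. The converse fails when i lies directly above i+1.
sortEntries-reflects-syt : ∀ i w {U} → 1 ≤ i → i < suc (length w) →
  sortEntries (ribbonOf w) i U ∈ syt (ribbonOf w) → U ∈ syt (ribbonOf w)
sortEntries-reflects-syt i w {U} 1≤i i<n U∈ with rowOf (ribbonOf w) U (suc i) ℕ.<? rowOf (ribbonOf w) U i
... | no ≮ = subst (_∈ syt (ribbonOf w)) (sortEntries-keep (ribbonOf w) ≮) U∈
... | yes lt with V↭ , oks ← ∈-syt-ribbonOf⁻ w (subst (_∈ syt (ribbonOf w)) (sortEntries-swap (ribbonOf w) lt) U∈) =
  subst (_∈ syt (ribbonOf w)) (swapEntries-involutive i U)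
    (∈-syt-ribbonOf⁺ w (swapEntries-↭ 1≤i i<n V↭)
      (swap-Ok i w (Unique-resp-↭ (↭-sym V↭) (oneTo-unique _)) oks
        (subst₂ _<_ (sym (rowOf-swap-lower (ribbonOf w) i U)) (sym (rowOf-swap-upper (ribbonOf w) i U)) lt)))

precedes : ℕ → ℕ → List ℕ → Bool
precedes a b [] = false
precedes a b (t ∷ U) = if t ≡ᵇ a then true else (if t ≡ᵇ b then false else precedes a b U)

∈-tail : ∀ {t e : ℕ} {U} → e ≢ t → e ∈ t ∷ U → e ∈ U
∈-tail ≢ (here eq) = ⊥-elim (≢ eq)
∈-tail _ (there e∈) = e∈

rowOf-≥ : ∀ {Q} x y {w U e} → Steps Q w U → e ∈ U → y ≤ rowOf (cells x y w) U e
rowOf-≥ x y ([-] {t}) (here refl) = ℕ.≤-reflexive (sym (rowOf-head x y [] t []))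
rowOf-≥ x y {e = e} (_∷_ {s} {t} {t′} {w} {U} _ qs) e∈ with t ℕ.≟ e
... | yes refl = ℕ.≤-reflexive (sym (rowOf-head x y (moves x y (s ∷ w)) t (t′ ∷ U)))
... | no t≢e = subst (y ≤_) (sym (rowOf-tail {x} {y} {cells (right s x) (up s y) w} {_} {t′ ∷ U} t≢e))
  (ℕ.≤-trans (up-≤ s y) (rowOf-≥ (right s x) (up s y) qs (∈-tail (t≢e ∘ sym) e∈)))

-- A row ascends, so a smaller entry can follow only after a step that leaves the row.
rowOf-> : ∀ x y {w t U e} → Steps Ok w (t ∷ U) → e ∈ U → e < t → y < rowOf (cells x y w) (t ∷ U) e
rowOf-> x y {e = e} (_∷_ {s} {t} {t′} {w} {U} ok oks) e∈ e<t =
  subst (y <_) (sym (rowOf-tail {x} {y} {cells (right s x) (up s y) w} {_} {t′ ∷ U} (ℕ.<⇒≢ e<t ∘ sym))) (go s ok)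
  where
  go : ∀ s → Ok s t t′ → y < rowOf (cells (right s x) (up s y) w) (t′ ∷ U) e
  go asc t<t′ = rowOf-> (suc x) y oks (∈-tail (ℕ.<⇒≢ (ℕ.<-trans e<t t<t′)) e∈) (ℕ.<-trans e<t t<t′)
  go desc _ = rowOf-≥ x (suc y) oks e∈
  go free _ = rowOf-≥ (suc x) (suc y) oks e∈

-- Rows weakly increase along the word, and if i+1 comes before i they cannot share a row. The
-- right-hand side no longer mentions the diagram, so on a word standard for two shapes the two
-- sorting operations agree.
rowOf-precedes : ∀ i x y {w U} → Steps Ok w U → i ∈ U → suc i ∈ U →
  (rowOf (cells x y w) U (suc i) <ᵇ rowOf (cells x y w) U i) ≡ precedes (suc i) i U
rowOf-precedes i x y [-] (here refl) (here ())
rowOf-precedes i x y oks′@(_∷_ {s} {t} {t′} {w} {U} ok oks) i∈ si∈ with t ℕ.≟ suc i | t ℕ.≟ i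
... | yes refl | _ rewrite ≡ᵇ-refl i =
  <⇒<ᵇ≡true (rowOf-> x y oks′ (∈-tail (ℕ.1+n≢n ∘ sym) i∈) (ℕ.n<1+n i))
... | no t≢si | yes refl rewrite ≢⇒≡ᵇ t≢si | ≡ᵇ-refl i =
  ≮⇒<ᵇ≡false (ℕ.≤⇒≯ (ℕ.≤-trans (up-≤ s y) (rowOf-≥ (right s x) (up s y) oks (∈-tail (t≢si ∘ sym) si∈))))
... | no t≢si | no t≢i rewrite ≢⇒≡ᵇ t≢si | ≢⇒≡ᵇ t≢i =
  rowOf-precedes i (right s x) (up s y) oks (∈-tail (t≢i ∘ sym) i∈) (∈-tail (t≢si ∘ sym) si∈)

-- Step words with open commas

data Skeleton : ℕ → Set where
  end : Skeleton 0
  fixed : ∀ {m} → Step → Skeleton m → Skeleton m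
  comma : ∀ {m} → Skeleton m → Skeleton (suc m)

fill : ∀ {m} → Skeleton m → Vec Step m → List Step
fill end [] = []
fill (fixed s k) S = s ∷ fill k S
fill (comma k) (s ∷ S) = s ∷ fill k S

width : ∀ {m} → Skeleton m → ℕ
width end = 0
width (fixed _ k) = suc (width k)
width (comma k) = suc (width k)

length-fill : ∀ {m} (k : Skeleton m) S → length (fill k S) ≡ width k
length-fill end [] = refl
length-fill (fixed s k) S = cong suc (length-fill k S)
length-fill (comma k) (s ∷ S) = cong suc (length-fill k S)

glueStep : Bool → Step
glueStep b = if b then asc else free

-- All shapes of the theorem share one skeleton: commas filled with `asc` and `free` give α⃗(I),
-- commas filled with `desc` give the concatenation (`stacked`).
glued : ∀ {m} → Skeleton m → Subset m → List Step
glued k I = fill k (Vec.map glueStep I)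

stacked : ∀ {m} → Skeleton m → List Step
stacked {m} k = fill k (Vec.replicate m desc)

infix 4 _≼_
_≼_ : ∀ {m} → Subset m → Subset m → Set
_≼_ = Pointwise 𝔹._≤_

≼-refl : ∀ {m} {I : Subset m} → I ≼ I
≼-refl = Pointwise.refl 𝔹.≤-refl

≼-trans : ∀ {m} {I J K : Subset m} → I ≼ J → J ≼ K → I ≼ K
≼-trans = Pointwise.trans 𝔹.≤-trans

⊥-≼ : ∀ {m} (I : Subset m) → ⊥ ≼ I
⊥-≼ [] = []
⊥-≼ (b ∷ I) = 𝔹.≤-minimum b ∷ ⊥-≼ I

≼-⊥ : ∀ {m} {I : Subset m} → I ≼ ⊥ → I ≡ ⊥
≼-⊥ [] = refl
≼-⊥ (b≤b ∷ I≼) = cong (false ∷_) (≼-⊥ I≼)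

-- The commas at which the reading word ascends: gluing I keeps a filling standard iff I lies in this set.
ascents : ∀ {m} → Skeleton m → List ℕ → Subset m
ascents (fixed _ k) (t ∷ U) = ascents k U
ascents (comma k) (t ∷ U@(t′ ∷ _)) = (t <ᵇ t′) ∷ ascents k U
ascents _ _ = ⊥

≤-glueStep : ∀ b {t t′} → Ok (glueStep b) t t′ → b 𝔹.≤ (t <ᵇ t′)
≤-glueStep false _ = 𝔹.≤-minimum _
≤-glueStep true t<t′ rewrite <⇒<ᵇ≡true t<t′ = b≤b

glueStep-≤ : ∀ b {t t′} → b 𝔹.≤ (t <ᵇ t′) → Ok (glueStep b) t t′
glueStep-≤ false _ = tt
glueStep-≤ true {t} {t′} b≤ with t <ᵇ t′ in eq
... | true = ℕ.<ᵇ⇒< t t′ (Equivalence.from 𝔹.T-≡ eq)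

glued⇒≼ascents : ∀ {m} (k : Skeleton m) {I U} → Steps Ok (glued k I) U → I ≼ ascents k U
glued⇒≼ascents end {[]} [-] = []
glued⇒≼ascents (fixed _ k) (_ ∷ oks) = glued⇒≼ascents k oks
glued⇒≼ascents (comma k) {b ∷ I} (ok ∷ oks) = ≤-glueStep b ok ∷ glued⇒≼ascents k oks

-- The steps inside the components do not depend on I, and the ascent set licenses each glued comma.
-- With `glued⇒≼ascents` this makes the sets J for which a word is standard the faces of a full
-- simplex.
glued-change : ∀ {m} (k : Skeleton m) {I J U} → Steps Ok (glued k I) U → J ≼ ascents k U → Steps Ok (glued k J) U
glued-change end {[]} {[]} [-] _ = [-]
glued-change (fixed _ k) (ok ∷ oks) J≼ = ok ∷ glued-change k oks J≼
glued-change (comma k) {_ ∷ _} {b ∷ J} (_ ∷ oks) (b≤ ∷ J≼) = glueStep-≤ b b≤ ∷ glued-change k oks J≼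

stacked⇒glued : ∀ {m} (k : Skeleton m) {U} → Steps Ok (stacked k) U → Steps Ok (glued k ⊥) U
stacked⇒glued end [-] = [-]
stacked⇒glued (fixed _ k) (ok ∷ oks) = ok ∷ stacked⇒glued k oks
stacked⇒glued (comma k) (_ ∷ oks) = tt ∷ stacked⇒glued k oks

stacked⇒ascents≡⊥ : ∀ {m} (k : Skeleton m) {U} → Steps Ok (stacked k) U → ascents k U ≡ ⊥
stacked⇒ascents≡⊥ end [-] = refl
stacked⇒ascents≡⊥ (fixed _ k) (_ ∷ oks) = stacked⇒ascents≡⊥ k oks
stacked⇒ascents≡⊥ (comma k) (ok ∷ oks) = cong₂ _∷_ (≮⇒<ᵇ≡false (ℕ.<-asym ok)) (stacked⇒ascents≡⊥ k oks)

-- For distinct entries, the absence of an ascent is a descent.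
ascents≡⊥⇒stacked : ∀ {m} (k : Skeleton m) {U} → Unique U → Steps Ok (glued k ⊥) U → ascents k U ≡ ⊥ → Steps Ok (stacked k) U
ascents≡⊥⇒stacked end _ [-] _ = [-]
ascents≡⊥⇒stacked (fixed _ k) (_ ∷ u) (ok ∷ oks) eq = ok ∷ ascents≡⊥⇒stacked k u oks eq
ascents≡⊥⇒stacked (comma k) {t ∷ t′ ∷ _} ((t≢ ∷ _) ∷ u) (_ ∷ oks) eq =
  ℕ.≤∧≢⇒< (ℕ.≮⇒≥ λ t<t′ → true≢false (trans (sym (<⇒<ᵇ≡true t<t′)) (Vec.∷-injectiveˡ eq))) (t≢ ∘ sym)
  ∷ ascents≡⊥⇒stacked k u oks (Vec.∷-injectiveʳ eq)
  where
  true≢false : true ≢ false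
  true≢false ()

-- Descents are demanded only at `fixed` steps, `glueStep` never producing one, so they carry over
-- from any I to any J.
glued-descents : ∀ {m} (k : Skeleton m) {I} J {U} → Steps Ok (glued k I) U → Steps (λ s a b → s ≡ desc → b < a) (glued k J) U
glued-descents end {[]} [] [-] = [-]
glued-descents (fixed _ k) J (ok ∷ oks) = (λ { refl → ok }) ∷ glued-descents k J oks
glued-descents (comma k) {_ ∷ _} (b ∷ J) (_ ∷ oks) = (λ eq → ⊥-elim (≢desc b eq)) ∷ glued-descents k J oks
  where
  ≢desc : ∀ b → glueStep b ≢ desc
  ≢desc false ()
  ≢desc true ()

-- Ascents of J survive because i and i+1 lie in different rows of J, hence never both at one `asc`
-- step; descents are borrowed from the standardness for I after the swap.
glued-swap : ∀ {m} (k : Skeleton m) {I} J i {U} → Unique U → Steps Ok (glued k J) U →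
  rowOf (ribbonOf (glued k J)) U (suc i) ≢ rowOf (ribbonOf (glued k J)) U i →
  Steps Ok (glued k I) (swapEntries i U) → Steps Ok (glued k J) (swapEntries i U)
glued-swap k J i {U} u oks ≢ oks′ = Steps-map (λ {s} → step s) (Steps-zip ascending (glued-descents k J oks′))
  where
  r = rowOf (ribbonOf (glued k J)) U
  ascending : Steps (λ s a b → s ≡ asc → a < b) (glued k J) (swapEntries i U)
  ascending = Steps-mapEntries (sw i) (Steps-map (λ { (ok , eq) refl → sw-mono-sameRow r (≢ ∘ sym) eq ok })
    (Steps-zip oks (rowOf-steps r 0 0 u oks λ _ → refl)))
  step : ∀ s {a b} → (s ≡ asc → a < b) × (s ≡ desc → b < a) → Ok s a b
  step asc (h , _) = h refl
  step desc (_ , h) = h refl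
  step free _ = tt

-- `free` and `desc` both climb one row and differ only in the column, which `rowOf` ignores. No
-- standardness is involved.
rowOf-stacked : ∀ {m} (k : Skeleton m) x x′ y U e → rowOf (cells x y (glued k ⊥)) U e ≡ rowOf (cells x′ y (stacked k)) U e
rowOf-stacked k x x′ y [] e = refl
rowOf-stacked end x x′ y (t ∷ U) e = refl
rowOf-stacked (fixed s k) x x′ y (t ∷ U) e rewrite rowOf-stacked k (right s x) (right s x′) (up s y) U e = refl
rowOf-stacked (comma k) x x′ y (t ∷ U) e rewrite rowOf-stacked k (suc x) x′ (suc y) U e = refl

-- Ribbons of sequences of compositions

-- A row of `a` boxes contributes `a - 1` steps, whence `pred`.
compositionWord : List ℕ → List Step
compositionWord [] = []
compositionWord (a ∷ []) = replicate (pred a) asc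
compositionWord (a ∷ α@(_ ∷ _)) = replicate (pred a) asc ++ desc ∷ compositionWord α

compositionWord-∷ : ∀ a {α} → IsNonemptyComposition α → compositionWord (a ∷ α) ≡ replicate (pred a) asc ++ desc ∷ compositionWord α
compositionWord-∷ a {_ ∷ _} _ = refl

valid-tail : ∀ {a b α} → IsNonemptyComposition (a ∷ b ∷ α) → IsNonemptyComposition (b ∷ α)
valid-tail (_ , _ ∷ pos) = s≤s z≤n , pos

valid-∷ : ∀ {a α} → 0 < a → IsNonemptyComposition α → IsNonemptyComposition (a ∷ α)
valid-∷ 0<a (_ , pos) = s≤s z≤n , 0<a ∷ pos

valid-⊙ : ∀ {α β} → IsNonemptyComposition α → IsNonemptyComposition β → IsNonemptyComposition (α ⊙ β)
valid-⊙ {a ∷ []} {b ∷ β} (_ , 0<a ∷ []) (_ , _ ∷ pos) = s≤s z≤n , ℕ.≤-trans 0<a (ℕ.m≤m+n a b) ∷ pos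
valid-⊙ {a ∷ _ ∷ _} vα@(_ , 0<a ∷ _) vβ = valid-∷ 0<a (valid-⊙ (valid-tail vα) vβ)

valid-++ : ∀ {α β} → IsNonemptyComposition α → IsNonemptyComposition β → IsNonemptyComposition (α ++ β)
valid-++ {_ ∷ _} (_ , posα) (_ , posβ) = s≤s z≤n , All.++⁺ posα posβ

replicate-+ : ∀ a b → replicate (a ℕ.+ b) asc ≡ replicate a asc ++ replicate b asc
replicate-+ zero b = refl
replicate-+ (suc a) b = cong (asc ∷_) (replicate-+ a b)

-- The merged row of a + b boxes has (a - 1) + 1 + (b - 1) ascents; the middle one is the glued
-- comma.
compositionWord-⊙ : ∀ {α β} → IsNonemptyComposition α → IsNonemptyComposition β → compositionWord (α ⊙ β) ≡ compositionWord α ++ asc ∷ compositionWord β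
compositionWord-⊙ {suc a ∷ []} {suc b ∷ []} _ _ = replicate-+ a (suc b)
compositionWord-⊙ {suc a ∷ []} {suc b ∷ b′ ∷ β} _ _ =
  trans (cong (_++ desc ∷ compositionWord (b′ ∷ β)) (replicate-+ a (suc b))) (List.++-assoc (replicate a asc) _ _)
compositionWord-⊙ {zero ∷ []} (_ , () ∷ _) _
compositionWord-⊙ {_ ∷ []} {zero ∷ _} _ (_ , () ∷ _)
compositionWord-⊙ {a ∷ a′ ∷ α} {β} vα vβ =
  trans (compositionWord-∷ a (valid-⊙ (valid-tail vα) vβ))
    (trans (cong (λ w → replicate (pred a) asc ++ desc ∷ w) (compositionWord-⊙ (valid-tail vα) vβ))
      (sym (List.++-assoc (replicate (pred a) asc) _ _)))

compositionWord-++ : ∀ {α β} → IsNonemptyComposition α → IsNonemptyComposition β → compositionWord (α ++ β) ≡ compositionWord α ++ desc ∷ compositionWord β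
compositionWord-++ {a ∷ []} {_ ∷ _} _ _ = refl
compositionWord-++ {a ∷ a′ ∷ α} {β} vα vβ =
  trans (cong (λ w → replicate (pred a) asc ++ desc ∷ w) (compositionWord-++ (valid-tail vα) vβ))
    (sym (List.++-assoc (replicate (pred a) asc) _ _))

sum-compositionWord : ∀ {α} → IsNonemptyComposition α → sum α ≡ suc (length (compositionWord α))
sum-compositionWord {zero ∷ _} (_ , () ∷ _)
sum-compositionWord {suc a ∷ []} _ = cong suc (trans (ℕ.+-identityʳ a) (sym (List.length-replicate a)))
sum-compositionWord {suc a ∷ b ∷ α} v = cong suc (trans
  (cong₂ ℕ._+_ (sym (List.length-replicate a)) (sum-compositionWord (valid-tail v)))
  (sym (List.length-++ (replicate a asc))))

lastX lastY : ℕ → List Step → ℕ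
lastX x [] = x
lastX x (s ∷ w) = lastX (right s x) w
lastY y [] = y
lastY y (s ∷ w) = lastY (up s y) w

moves-++ : ∀ x y w s w′ → moves x y (w ++ s ∷ w′) ≡ moves x y w ++ cells (right s (lastX x w)) (up s (lastY y w)) w′
moves-++ x y [] s w′ = refl
moves-++ x y (s₀ ∷ w) s w′ = cong (_ ∷_) (moves-++ (right s₀ x) (up s₀ y) w s w′)

lastX-++ : ∀ x w s w′ → lastX x (w ++ s ∷ w′) ≡ lastX (right s (lastX x w)) w′
lastX-++ x [] s w′ = refl
lastX-++ x (s₀ ∷ w) s w′ = lastX-++ (right s₀ x) w s w′

lastY-++ : ∀ y w s w′ → lastY y (w ++ s ∷ w′) ≡ lastY (up s (lastY y w)) w′
lastY-++ y [] s w′ = refl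
lastY-++ y (s₀ ∷ w) s w′ = lastY-++ (up s₀ y) w s w′

rowCells-moves : ∀ x y a → rowCells x y (suc a) ≡ cells x y (replicate a asc)
rowCells-moves x y zero = refl
rowCells-moves x y (suc a) = cong ((x , y) ∷_) (rowCells-moves (suc x) y a)

lastX-row : ∀ x a → lastX x (replicate a asc) ≡ x ℕ.+ suc a ∸ 1
lastX-row x a rewrite ℕ.+-suc x a = go x a
  where
  go : ∀ x a → lastX x (replicate a asc) ≡ x ℕ.+ a
  go x zero = sym (ℕ.+-identityʳ x)
  go x (suc a) = trans (go (suc x) a) (sym (ℕ.+-suc x a))

lastY-row : ∀ y a → lastY y (replicate a asc) ≡ y
lastY-row y zero = refl
lastY-row y (suc a) = lastY-row y a

ribbon-cells : ∀ x y {α} → IsNonemptyComposition α → ribbon x y α ≡ cells x y (compositionWord α)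
ribbon-cells x y {zero ∷ _} (_ , () ∷ _)
ribbon-cells x y {suc a ∷ []} _ = trans (List.++-identityʳ _) (rowCells-moves x y a)
ribbon-cells x y {suc a ∷ b ∷ α} v
  = trans (cong₂ _++_ (rowCells-moves x y a) (ribbon-cells (x ℕ.+ suc a ∸ 1) (suc y) (valid-tail v)))
    (cong ((x , y) ∷_) (sym (trans (moves-++ x y (replicate a asc) desc (compositionWord (b ∷ α)))
      (cong₂ (λ x′ y′ → moves x y (replicate a asc) ++ cells x′ (suc y′) (compositionWord (b ∷ α))) (lastX-row x a) (lastY-row y a)))))

endX-lastX : ∀ x {α} → IsNonemptyComposition α → endX x α ≡ lastX x (compositionWord α)
endX-lastX x {zero ∷ _} (_ , () ∷ _)
endX-lastX x {suc a ∷ []} _ = sym (lastX-row x a)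
endX-lastX x {suc a ∷ b ∷ α} v
  = trans (endX-lastX (x ℕ.+ suc a ∸ 1) (valid-tail v)) (sym (trans (lastX-++ x (replicate a asc) desc (compositionWord (b ∷ α)))
    (cong (λ x′ → lastX x′ (compositionWord (b ∷ α))) (lastX-row x a))))

length-lastY : ∀ y {α} → IsNonemptyComposition α → y ℕ.+ length α ≡ suc (lastY y (compositionWord α))
length-lastY y {zero ∷ _} (_ , () ∷ _)
length-lastY y {suc a ∷ []} _ = trans (ℕ.+-comm y 1) (cong suc (sym (lastY-row y a)))
length-lastY y {suc a ∷ b ∷ α} v
  = trans (ℕ.+-suc y (suc (length α))) (trans (length-lastY (suc y) (valid-tail v))
    (cong suc (sym (trans (lastY-++ y (replicate a asc) desc (compositionWord (b ∷ α)))
      (cong (λ y′ → lastY (suc y′) (compositionWord (b ∷ α))) (lastY-row y a))))))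

prefix : ∀ {m} → List Step → Skeleton m → Skeleton m
prefix [] k = k
prefix (s ∷ w) k = fixed s (prefix w k)

fill-prefix : ∀ {m} w (k : Skeleton m) S → fill (prefix w k) S ≡ w ++ fill k S
fill-prefix [] k S = refl
fill-prefix (s ∷ w) k S = cong (s ∷_) (fill-prefix w k S)

width-prefix : ∀ {m} w (k : Skeleton m) → width (prefix w k) ≡ length w ℕ.+ width k
width-prefix [] k = refl
width-prefix (s ∷ w) k = cong suc (width-prefix w k)

skeleton : ∀ {m} → List ℕ → Vec (List ℕ) m → Skeleton m
skeleton α [] = prefix (compositionWord α) end
skeleton α (β ∷ βs) = prefix (compositionWord α) (comma (skeleton β βs))

AllNonempty : ∀ {m} → Vec (List ℕ) m → Set
AllNonempty αs = ∀ j → IsNonemptyComposition (lookup αs j)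

-- `glue` accumulates glued components into α ⊙ β before going on; in terms of words this amounts to
-- filling the comma with `asc`.
fill-⊙ : ∀ {m α β} (βs : Vec (List ℕ) m) S → IsNonemptyComposition α → IsNonemptyComposition β →
  fill (skeleton (α ⊙ β) βs) S ≡ compositionWord α ++ asc ∷ fill (skeleton β βs) S
fill-⊙ {α = α} {β} [] S vα vβ
  rewrite fill-prefix (compositionWord (α ⊙ β)) end S | fill-prefix (compositionWord β) end S
        | compositionWord-⊙ vα vβ = List.++-assoc (compositionWord α) _ _
fill-⊙ {α = α} {β} (γ ∷ βs) S vα vβ
  rewrite fill-prefix (compositionWord (α ⊙ β)) (comma (skeleton γ βs)) S | fill-prefix (compositionWord β) (comma (skeleton γ βs)) S
        | compositionWord-⊙ vα vβ = List.++-assoc (compositionWord α) _ _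

genRibbon-cells : ∀ {m} x y α (βs : Vec (List ℕ) m) I → AllNonempty (α ∷ βs) →
  genRibbon x y (glue α βs I) ≡ cells x y (glued (skeleton α βs) I)
genRibbon-cells x y α [] [] v rewrite fill-prefix (compositionWord α) end [] | List.++-identityʳ (compositionWord α) =
  trans (List.++-identityʳ _) (ribbon-cells x y (v zero))
genRibbon-cells x y α (β ∷ βs) (true ∷ I) v =
  trans (genRibbon-cells x y (α ⊙ β) βs I λ { zero → valid-⊙ (v zero) (v (suc zero)) ; (suc j) → v (suc (suc j)) })
    (cong (cells x y) (trans (fill-⊙ βs (Vec.map glueStep I) (v zero) (v (suc zero)))
      (sym (fill-prefix (compositionWord α) (comma (skeleton β βs)) (asc ∷ Vec.map glueStep I)))))
genRibbon-cells x y α (β ∷ βs) (false ∷ I) v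
  rewrite fill-prefix (compositionWord α) (comma (skeleton β βs)) (free ∷ Vec.map glueStep I)
        | moves-++ x y (compositionWord α) free (glued (skeleton β βs) I)
        | endX-lastX x (v zero) | length-lastY y (v zero) =
  cong₂ _++_ (ribbon-cells x y (v zero)) (genRibbon-cells _ _ β βs I (v ∘ suc))

valid-concat : ∀ {m} α (βs : Vec (List ℕ) m) → AllNonempty (α ∷ βs) → IsNonemptyComposition (concatAll (α ∷ βs))
valid-concat α [] v rewrite List.++-identityʳ α = v zero
valid-concat α (β ∷ βs) v = valid-++ (v zero) (valid-concat β βs (v ∘ suc))

compositionWord-concat : ∀ {m} α (βs : Vec (List ℕ) m) → AllNonempty (α ∷ βs) →
  compositionWord (concatAll (α ∷ βs)) ≡ stacked (skeleton α βs)
compositionWord-concat α [] v rewrite List.++-identityʳ α =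
  sym (trans (fill-prefix (compositionWord α) end []) (List.++-identityʳ _))
compositionWord-concat α (β ∷ βs) v =
  trans (compositionWord-++ (v zero) (valid-concat β βs (v ∘ suc)))
    (trans (cong (λ w → compositionWord α ++ desc ∷ w) (compositionWord-concat β βs (v ∘ suc)))
      (sym (fill-prefix (compositionWord α) (comma (skeleton β βs)) _)))

size-width : ∀ {m} α (βs : Vec (List ℕ) m) → AllNonempty (α ∷ βs) → size (α ∷ βs) ≡ suc (width (skeleton α βs))
size-width α [] v rewrite width-prefix (compositionWord α) end = cong (ℕ._+ 0) (sum-compositionWord (v zero))
size-width α (β ∷ βs) v rewrite width-prefix (compositionWord α) (comma (skeleton β βs)) =
  cong₂ ℕ._+_ (sum-compositionWord (v zero)) (size-width β βs (v ∘ suc))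

Diag-glued : ∀ {m} (αs : Vec (List ℕ) (suc m)) → AllNonempty αs → ∀ I → Diag (seqAt αs I) ≡ ribbonOf (glued (skeleton (Vec.head αs) (Vec.tail αs)) I)
Diag-glued (α ∷ αs) v I = genRibbon-cells 0 0 α αs I v

Diag-stacked : ∀ {m} (αs : Vec (List ℕ) (suc m)) → AllNonempty αs → Diag (concatAll αs ∷ []) ≡ ribbonOf (stacked (skeleton (Vec.head αs) (Vec.tail αs)))
Diag-stacked (α ∷ αs) v = trans (List.++-identityʳ _)
  (trans (ribbon-cells 0 0 (valid-concat α αs v)) (cong ribbonOf (compositionWord-concat α αs v)))

-- The Hecke action

==F-true : ∀ {U V} → U ≡ V → (U ==F V) ≡ true
==F-true = dec-true (List.≡-dec ℕ._≟_ _ _)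

==F-false : ∀ {U V} → U ≢ V → (U ==F V) ≡ false
==F-false = dec-false (List.≡-dec ℕ._≟_ _ _)

∈⇒tab : ∀ D {U} → U ∈ syt D → ∃ λ t → tab D t ≡ U
∈⇒tab D U∈ = Any.index U∈ , sym (Any.lookup-index U∈)

tab-∈ : ∀ D t → tab D t ∈ syt D
tab-∈ D t = ∈.∈-lookup t

module Vectors {c ℓ} (F : Field c ℓ) where
  open Field F hiding (zero) renaming (refl to ≈-refl; sym to ≈-sym; trans to ≈-trans)
  open import Algebra.Properties.Ring ring using (-‿distribʳ-*; -0#≈0#; -‿+-comm)
  open import Algebra.Properties.CommutativeSemigroup (CommutativeRing.+-commutativeSemigroup commutativeRing) using (interchange)
  open import Relation.Binary.Reasoning.Setoid (CommutativeRing.setoid commutativeRing)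

  sumFin-cong : ∀ {k} {f g : Fin k → Carrier} → (∀ i → f i ≈ g i) → sumFin F f ≈ sumFin F g
  sumFin-cong {zero} h = ≈-refl
  sumFin-cong {suc k} h = +-cong (h zero) (sumFin-cong (h ∘ suc))

  sumFin-zero : ∀ {k} {f : Fin k → Carrier} → (∀ i → f i ≈ 0#) → sumFin F f ≈ 0#
  sumFin-zero {zero} h = ≈-refl
  sumFin-zero {suc k} h = ≈-trans (+-cong (h zero) (sumFin-zero (h ∘ suc))) (+-identityˡ 0#)

  sumFin-+ : ∀ {k} (f g : Fin k → Carrier) → sumFin F (λ i → f i + g i) ≈ sumFin F f + sumFin F g
  sumFin-+ {zero} f g = ≈-sym (+-identityˡ 0#)
  sumFin-+ {suc k} f g = ≈-trans (+-congˡ (sumFin-+ (f ∘ suc) (g ∘ suc))) (interchange _ _ _ _)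

  sumFin-*ˡ : ∀ {k} a (f : Fin k → Carrier) → sumFin F (λ i → a * f i) ≈ a * sumFin F f
  sumFin-*ˡ {zero} a f = ≈-sym (zeroʳ a)
  sumFin-*ˡ {suc k} a f = ≈-trans (+-congˡ (sumFin-*ˡ a (f ∘ suc))) (≈-sym (distribˡ a _ _))

  sumFin-neg : ∀ {k} (f : Fin k → Carrier) → sumFin F (λ i → - f i) ≈ - sumFin F f
  sumFin-neg {zero} f = ≈-sym -0#≈0#
  sumFin-neg {suc k} f = ≈-trans (+-congˡ (sumFin-neg (f ∘ suc))) (-‿+-comm _ _)

  sumFin-single : ∀ {k} {f : Fin k → Carrier} i → (∀ j → j ≢ i → f j ≈ 0#) → sumFin F f ≈ f i
  sumFin-single {suc k} zero h = ≈-trans (+-congˡ (sumFin-zero λ j → h (suc j) λ ())) (+-identityʳ _)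
  sumFin-single {suc k} (suc i) h =
    ≈-trans (+-cong (h zero λ ()) (sumFin-single i λ j j≢i → h (suc j) λ { refl → j≢i refl })) (+-identityˡ _)

  -- Extension by zero to all fillings. The formula is that of the innermost sum of `∂`, so `∂` is
  -- by definition a signed sum of such values.
  hat : (D : List Cell) → P F D → Filling → Carrier
  hat D v U = sumFin F (λ t → v t * ind F (tab D t ==F U))

  hat-cong : ∀ D {v w : P F D} U → (∀ t → v t ≈ w t) → hat D v U ≈ hat D w U
  hat-cong D U h = sumFin-cong λ t → *-congʳ (h t)

  hat-+ : ∀ D (v w : P F D) U → hat D (λ t → v t + w t) U ≈ hat D v U + hat D w U
  hat-+ D v w U = ≈-trans (sumFin-cong {dim D} λ t → distribʳ _ _ _) (sumFin-+ {dim D} _ _)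

  hat-* : ∀ D a (v : P F D) U → hat D (λ t → a * v t) U ≈ a * hat D v U
  hat-* D a v U = ≈-trans (sumFin-cong {dim D} λ t → *-assoc _ _ _) (sumFin-*ˡ {dim D} a _)

  hat-zero : ∀ D {v : P F D} U → (∀ t → v t ≈ 0#) → hat D v U ≈ 0#
  hat-zero D U h = sumFin-zero λ t → ≈-trans (*-congʳ (h t)) (zeroˡ _)

  hat-tab : ∀ D (v : P F D) t → hat D v (tab D t) ≈ v t
  hat-tab D v t = begin
    hat D v (tab D t)                    ≈⟨ sumFin-single t (λ t′ t′≢t → ≈-trans (*-congˡ (reflexive (cong (ind F) (==F-false (t′≢t ∘ tab-injective D t′ t))))) (zeroʳ _)) ⟩
    v t * ind F (tab D t ==F tab D t)    ≡⟨ cong (λ b → v t * ind F b) (==F-true {tab D t} refl) ⟩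
    v t * 1#                             ≈⟨ *-identityʳ _ ⟩
    v t                                  ∎

  hat-at : ∀ D (v : P F D) {U} t → tab D t ≡ U → hat D v U ≈ v t
  hat-at D v t refl = hat-tab D v t

  hat-∉ : ∀ D (v : P F D) {U} → U ∉ syt D → hat D v U ≈ 0#
  hat-∉ D v {U} U∉ = sumFin-zero λ t →
    ≈-trans (*-congˡ (reflexive (cong (ind F) (==F-false λ eq → U∉ (subst (_∈ syt D) eq (tab-∈ D t)))))) (zeroʳ _)

  -- The matrix of π̄_i is defined by cases on the source `t`; here it is read off at the target
  -- `t′`, where only the swapped tableau and `t′` itself contribute. The filling is abstracted in
  -- `go` to allow rewriting.
  coefπ̄-sort : ∀ D i t′ t → rowOf D (tab D t′) (suc i) < rowOf D (tab D t′) i →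
    coefπ̄ F D i t′ t ≈ ind F (tab D t ==F swapEntries i (tab D t′)) + - ind F (tab D t ==F tab D t′)
  coefπ̄-sort D i t′ t lt = go (tab D t) (tab D t′) lt
    where
    go : ∀ U U′ → rowOf D U′ (suc i) < rowOf D U′ i →
      (if rowOf D U (suc i) <ᵇ rowOf D U i then - ind F (U′ ==F U)
        else (if rowOf D U i <ᵇ rowOf D U (suc i) then ind F (U′ ==F swapEntries i U) else 0#))
      ≈ ind F (U ==F swapEntries i U′) + - ind F (U ==F U′)
    go U U′ lt with List.≡-dec ℕ._≟_ U U′ | List.≡-dec ℕ._≟_ U (swapEntries i U′)
    -- A filling fixed by the swap would have i and i+1 in the same row.
    ... | yes refl | yes eq = ⊥-elim (ℕ.<-irrefl (trans (cong (λ V → rowOf D V (suc i)) eq) (rowOf-swap-upper D i U)) lt)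
    ... | yes refl | no ≢ rewrite <⇒<ᵇ≡true lt | ==F-true {U} refl = ≈-sym (+-identityˡ _)
    ... | no ≢ | yes refl
      rewrite rowOf-swap-upper D i U′ | rowOf-swap-lower D i U′ | ≮⇒<ᵇ≡false (ℕ.<-asym lt) | <⇒<ᵇ≡true lt
            | ==F-true (sym (swapEntries-involutive i U′)) = ≈-sym (≈-trans (+-congˡ -0#≈0#) (+-identityʳ _))
    ... | no ≢ | no ≢′
      rewrite ==F-false (≢ ∘ sym) | ==F-false {U′} {swapEntries i U} (λ { refl → ≢′ (sym (swapEntries-involutive i U)) })
      with rowOf D U (suc i) <ᵇ rowOf D U i | rowOf D U i <ᵇ rowOf D U (suc i)
    ...   | true | _ = ≈-sym (+-identityˡ _)
    ...   | false | true = ≈-sym (≈-trans (+-congˡ -0#≈0#) (+-identityʳ _))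
    ...   | false | false = ≈-sym (≈-trans (+-congˡ -0#≈0#) (+-identityʳ _))

  coefπ̄-keep : ∀ D i t′ t → ¬ rowOf D (tab D t′) (suc i) < rowOf D (tab D t′) i → coefπ̄ F D i t′ t ≈ 0#
  coefπ̄-keep D i t′ t ≮ = go (tab D t) (tab D t′) ≮
    where
    go : ∀ U U′ → ¬ rowOf D U′ (suc i) < rowOf D U′ i →
      (if rowOf D U (suc i) <ᵇ rowOf D U i then - ind F (U′ ==F U)
        else (if rowOf D U i <ᵇ rowOf D U (suc i) then ind F (U′ ==F swapEntries i U) else 0#)) ≈ 0#
    go U U′ ≮ with rowOf D U (suc i) ℕ.<? rowOf D U i
    ... | yes lt rewrite <⇒<ᵇ≡true lt | ==F-false {U′} {U} (λ { refl → ≮ lt }) = -0#≈0#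
    ... | no ≮′ rewrite ≮⇒<ᵇ≡false ≮′ with rowOf D U i ℕ.<? rowOf D U (suc i)
    ...   | no ≮″ rewrite ≮⇒<ᵇ≡false ≮″ = ≈-refl
    ...   | yes lt rewrite <⇒<ᵇ≡true lt | ==F-false {U′} {swapEntries i U} (λ { refl →
      ≮ (subst₂ _<_ (sym (rowOf-swap-upper D i U)) (sym (rowOf-swap-lower D i U)) lt) }) = ≈-refl

  -- When the rows call for a swap, the diagonal -1 of π̄_i cancels the identity in π_i = π̄_i + 1
  -- and leaves the coefficient at the swapped filling; otherwise only the identity contributes.
  π-hat : ∀ D i (v : P F D) t → π F D i v t ≈ hat D v (sortEntries D i (tab D t))
  π-hat D i v t′ with rowOf D (tab D t′) (suc i) ℕ.<? rowOf D (tab D t′) i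
  ... | no ≮ = begin
    π̄ F D i v t′ + v t′                      ≈⟨ +-congʳ (sumFin-zero λ t → ≈-trans (*-congʳ (coefπ̄-keep D i t′ t ≮)) (zeroˡ _)) ⟩
    0# + v t′                                ≈⟨ +-identityˡ _ ⟩
    v t′                                     ≈⟨ hat-tab D v t′ ⟨
    hat D v (tab D t′)                       ≡⟨ cong (hat D v) (sortEntries-keep D ≮) ⟨
    hat D v (sortEntries D i (tab D t′))     ∎
  ... | yes lt = begin
    π̄ F D i v t′ + v t′                      ≈⟨ +-congʳ (sumFin-cong λ t → expand (v t) (coefπ̄-sort D i t′ t lt)) ⟩
    sumFin F (λ t → v t * ind F (tab D t ==F swapEntries i (tab D t′)) + - (v t * ind F (tab D t ==F tab D t′))) + v t′
                                             ≈⟨ +-congʳ (sumFin-+ {dim D} _ _) ⟩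
    (hat D v (swapEntries i (tab D t′)) + sumFin F (λ t → - (v t * ind F (tab D t ==F tab D t′)))) + v t′
                                             ≈⟨ +-congʳ (+-congˡ (≈-trans (sumFin-neg {dim D} _) (-‿cong (hat-tab D v t′)))) ⟩
    (hat D v (swapEntries i (tab D t′)) + - v t′) + v t′
                                             ≈⟨ +-assoc _ _ _ ⟩
    hat D v (swapEntries i (tab D t′)) + (- v t′ + v t′)
                                             ≈⟨ +-congˡ (-‿inverseˡ _) ⟩
    hat D v (swapEntries i (tab D t′)) + 0#  ≈⟨ +-identityʳ _ ⟩
    hat D v (swapEntries i (tab D t′))       ≡⟨ cong (hat D v) (sortEntries-swap D lt) ⟨
    hat D v (sortEntries D i (tab D t′))     ∎
    where
    expand : ∀ {a b c} v → a ≈ b + - c → a * v ≈ v * b + - (v * c)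
    expand v eq = ≈-trans (*-comm _ _) (≈-trans (*-congˡ eq) (≈-trans (distribˡ _ _ _) (+-congˡ (≈-sym (-‿distribʳ-* _ _)))))

  SortReflects : List Cell → ℕ → Set
  SortReflects D i = ∀ {U} → sortEntries D i U ∈ syt D → U ∈ syt D

  -- This extends `π-hat` to non-standard fillings, where the left side is 0 and `SortReflects`
  -- makes the right side 0. It is what allows products of π's to be evaluated.
  hat-π : ∀ D i → SortReflects D i → ∀ (v : P F D) U → hat D (π F D i v) U ≈ hat D v (sortEntries D i U)
  hat-π D i reflects v U with U ∈F? syt D
  ... | no U∉ = ≈-trans (hat-∉ D _ U∉) (≈-sym (hat-∉ D v (U∉ ∘ reflects)))
  ... | yes U∈ with t , refl ← ∈⇒tab D U∈ = ≈-trans (hat-tab D _ t) (π-hat D i v t)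

  π-idem : ∀ D i → SortReflects D i → ∀ v t → π F D i (π F D i v) t ≈ π F D i v t
  π-idem D i ri v t = begin
    π F D i (π F D i v) t                                     ≈⟨ π-hat D i _ t ⟩
    hat D (π F D i v) (sortEntries D i (tab D t))             ≈⟨ hat-π D i ri v _ ⟩
    hat D v (sortEntries D i (sortEntries D i (tab D t)))     ≡⟨ cong (hat D v) (sortEntries-idem D i _) ⟩
    hat D v (sortEntries D i (tab D t))                       ≈⟨ π-hat D i v t ⟨
    π F D i v t                                               ∎

  π-comm : ∀ D i j → SortReflects D i → SortReflects D j → i ≢ j → i ≢ suc j → suc i ≢ j → ∀ v t →
    π F D i (π F D j v) t ≈ π F D j (π F D i v) t
  π-comm D i j ri rj i≢j i≢sj si≢j v t = begin
    π F D i (π F D j v) t                                     ≈⟨ π-hat D i _ t ⟩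
    hat D (π F D j v) (sortEntries D i (tab D t))             ≈⟨ hat-π D j rj v _ ⟩
    hat D v (sortEntries D j (sortEntries D i (tab D t)))     ≡⟨ cong (hat D v) (sortEntries-comm D i j _ i≢j i≢sj si≢j) ⟨
    hat D v (sortEntries D i (sortEntries D j (tab D t)))     ≈⟨ hat-π D i ri v _ ⟨
    hat D (π F D i v) (sortEntries D j (tab D t))             ≈⟨ π-hat D j _ t ⟨
    π F D j (π F D i v) t                                     ∎

  π-braid : ∀ D i → SortReflects D i → SortReflects D (suc i) → ∀ v t →
    π F D i (π F D (suc i) (π F D i v)) t ≈ π F D (suc i) (π F D i (π F D (suc i) v)) t
  π-braid D i ri rj v t = begin
    π F D i (π F D (suc i) (π F D i v)) t                     ≈⟨ π-hat³ i (suc i) i rj ri ⟩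
    hat D v (sortEntries D i (sortEntries D (suc i) (sortEntries D i (tab D t))))
                                                              ≡⟨ cong (hat D v) (sortEntries-braid D i _) ⟩
    hat D v (sortEntries D (suc i) (sortEntries D i (sortEntries D (suc i) (tab D t))))
                                                              ≈⟨ π-hat³ (suc i) i (suc i) ri rj ⟨
    π F D (suc i) (π F D i (π F D (suc i) v)) t               ∎
    where
    -- Precomposition reverses the order of the operators, which the palindromic braid words do not
    -- notice.
    π-hat³ : ∀ i j k → SortReflects D j → SortReflects D k →
      π F D i (π F D j (π F D k v)) t ≈ hat D v (sortEntries D k (sortEntries D j (sortEntries D i (tab D t))))
    π-hat³ i j k rj rk = ≈-trans (π-hat D i _ t) (≈-trans (hat-π D j rj _ _) (hat-π D k rk v _))

-- Cochains of a simplex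

infix 4 _⋖_
-- J is I with one element added: the pairs that contribute to the coboundary `δ` at J.
data _⋖_ : ∀ {m} → Subset m → Subset m → Set where
  here : ∀ {m} {I : Subset m} → false ∷ I ⋖ true ∷ I
  there : ∀ {m b} {I J : Subset m} → I ⋖ J → b ∷ I ⋖ b ∷ J

⋖⇒≼ : ∀ {m} {I J : Subset m} → I ⋖ J → I ≼ J
⋖⇒≼ here = f≤t ∷ ≼-refl
⋖⇒≼ (there I⋖J) = b≤b ∷ ⋖⇒≼ I⋖J

⋖⇒∣∣ : ∀ {m} {I J : Subset m} → I ⋖ J → ∣ J ∣ ≡ suc ∣ I ∣
⋖⇒∣∣ here = refl
⋖⇒∣∣ (there {b = false} I⋖J) = ⋖⇒∣∣ I⋖J
⋖⇒∣∣ (there {b = true} I⋖J) = cong suc (⋖⇒∣∣ I⋖J)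

¬⋖⊥ : ∀ {m} {I : Subset m} → ¬ I ⋖ ⊥
¬⋖⊥ (there I⋖⊥) = ¬⋖⊥ I⋖⊥

module Koszul {c ℓ} (F : Field c ℓ) where
  open Field F hiding (zero) renaming (refl to ≈-refl; sym to ≈-sym; trans to ≈-trans)
  open import Algebra.Properties.Ring ring using (-‿distribˡ-*; -‿distribʳ-*; -0#≈0#; -‿+-comm)
  open import Relation.Binary.Reasoning.Setoid (CommutativeRing.setoid commutativeRing)
  open Vectors F

  -- The simplicial coboundary with the first vertex split off. Adding a later vertex to a set that
  -- contains the first one counts one more element below it, hence the minus sign.
  δ : ∀ {m} → (Subset m → Carrier) → Subset m → Carrier
  δ g [] = 0#
  δ g (false ∷ I) = δ (λ J → g (false ∷ J)) I
  δ g (true ∷ I) = g (false ∷ I) + - δ (λ J → g (true ∷ J)) I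

  δ-cong : ∀ {m} {g h : Subset m → Carrier} J → (∀ {I} → I ⋖ J → g I ≈ h I) → δ g J ≈ δ h J
  δ-cong [] _ = ≈-refl
  δ-cong (false ∷ J) h = δ-cong J (h ∘ there)
  δ-cong (true ∷ J) h = +-cong (h here) (-‿cong (δ-cong J (h ∘ there)))

  δ-0 : ∀ {m} (J : Subset m) → δ (λ _ → 0#) J ≈ 0#
  δ-0 [] = ≈-refl
  δ-0 (false ∷ J) = δ-0 J
  δ-0 (true ∷ J) = ≈-trans (+-identityˡ _) (≈-trans (-‿cong (δ-0 J)) -0#≈0#)

  δ-zero : ∀ {m} {g : Subset m → Carrier} J → (∀ {I} → I ⋖ J → g I ≈ 0#) → δ g J ≈ 0#
  δ-zero J h = ≈-trans (δ-cong J h) (δ-0 J)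

  x-x≈0 : ∀ {x y} → x ≈ y → x + - y ≈ 0#
  x-x≈0 eq = ≈-trans (+-congʳ eq) (-‿inverseʳ _)

  δ-+ : ∀ {m} (g h : Subset m → Carrier) J → δ (λ I → g I + h I) J ≈ δ g J + δ h J
  δ-+ g h [] = ≈-sym (+-identityˡ 0#)
  δ-+ g h (false ∷ J) = δ-+ _ _ J
  δ-+ g h (true ∷ J) = ≈-trans (+-congˡ (≈-trans (-‿cong (δ-+ _ _ J)) (≈-sym (-‿+-comm _ _)))) (interchange _ _ _ _)
    where open import Algebra.Properties.CommutativeSemigroup (CommutativeRing.+-commutativeSemigroup commutativeRing) using (interchange)

  δ-* : ∀ {m} a (g : Subset m → Carrier) J → δ (λ I → a * g I) J ≈ a * δ g J
  δ-* a g [] = ≈-sym (zeroʳ a)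
  δ-* a g (false ∷ J) = δ-* a _ J
  δ-* a g (true ∷ J) = ≈-trans (+-congˡ (≈-trans (-‿cong (δ-* a _ J)) (-‿distribʳ-* _ _))) (≈-sym (distribˡ a _ _))

  δ-neg : ∀ {m} (g : Subset m → Carrier) J → δ (λ I → - g I) J ≈ - δ g J
  δ-neg g [] = ≈-sym -0#≈0#
  δ-neg g (false ∷ J) = δ-neg _ J
  δ-neg g (true ∷ J) = ≈-trans (+-congˡ (-‿cong (δ-neg _ J))) (-‿+-comm _ _)

  -- If J contains the first vertex, that vertex can be added last or first; the two terms cancel,
  -- and what remains is a `δ` of a `δ` on fewer vertices.
  δ-δ : ∀ {m} (g : Subset m → Carrier) J → δ (δ g) J ≈ 0#
  δ-δ g [] = ≈-refl
  δ-δ g (false ∷ J) = δ-δ _ J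
  δ-δ g (true ∷ J) = x-x≈0 (≈-sym (begin
    δ (λ I → g (false ∷ I) + - δ (λ K → g (true ∷ K)) I) J             ≈⟨ δ-+ _ _ J ⟩
    δ (λ I → g (false ∷ I)) J + δ (λ I → - δ (λ K → g (true ∷ K)) I) J ≈⟨ +-congˡ (≈-trans (δ-neg _ J) (≈-trans (-‿cong (δ-δ _ J)) -0#≈0#)) ⟩
    δ (λ I → g (false ∷ I)) J + 0#                                     ≈⟨ +-identityʳ _ ⟩
    δ (λ I → g (false ∷ I)) J                                          ∎))

  sumSub-cong : ∀ {m} {f g : Subset m → Carrier} → (∀ I → f I ≈ g I) → sumSub F f ≈ sumSub F g
  sumSub-cong {zero} h = h []
  sumSub-cong {suc m} h = +-cong (sumSub-cong {m} λ I → h (false ∷ I)) (sumSub-cong {m} λ I → h (true ∷ I))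

  sumSub-zero : ∀ {m} {f : Subset m → Carrier} → (∀ I → f I ≈ 0#) → sumSub F f ≈ 0#
  sumSub-zero {zero} h = h []
  sumSub-zero {suc m} h = ≈-trans (+-cong (sumSub-zero λ I → h (false ∷ I)) (sumSub-zero λ I → h (true ∷ I))) (+-identityˡ 0#)

  sumSub-neg : ∀ {m} (f : Subset m → Carrier) → sumSub F (λ I → - f I) ≈ - sumSub F f
  sumSub-neg {zero} f = ≈-refl
  sumSub-neg {suc m} f = ≈-trans (+-cong (sumSub-neg {m} _) (sumSub-neg {m} _)) (-‿+-comm _ _)

  ind-false : ∀ {b} x → b ≡ false → ind F b * x ≈ 0#
  ind-false x refl = zeroˡ x

  sumSub-ind : ∀ {m} (g : Subset m → Carrier) J → sumSub F (λ I → ind F (I ==S J) * g I) ≈ g J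
  sumSub-ind g [] = *-identityˡ _
  sumSub-ind {suc m} g (false ∷ J) = ≈-trans (+-cong (sumSub-ind _ J) (sumSub-zero {m} λ I → zeroˡ _)) (+-identityʳ _)
  sumSub-ind {suc m} g (true ∷ J) = ≈-trans (+-cong (sumSub-zero {m} λ I → zeroˡ _) (sumSub-ind _ J)) (+-identityˡ _)

  coboundaryTerm : ∀ {m} → (Subset m → Carrier) → Subset m → Subset m → Fin m → Carrier
  coboundaryTerm g J I j = ind F (not (lookup I j) ∧ ((I ∪ ⁅ j ⁆) ==S J)) * (sgnPow F (countBelow I j) * g I)

  -- If J contains the first vertex, either I omits it, and then j is that vertex and I is the rest
  -- of J, or I contains it, and each sign gains a factor -1. If J omits it, so do I and j.
  coboundary-δ : ∀ {m} (g : Subset m → Carrier) J → sumSub F (λ I → sumFin F (coboundaryTerm g J I)) ≈ δ g J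
  coboundary-δ g [] = ≈-refl
  coboundary-δ {suc m} g (false ∷ J) = ≈-trans
    (+-cong
      (≈-trans (sumSub-cong {m} λ I → ≈-trans (+-congʳ (zeroˡ _)) (+-identityˡ _)) (coboundary-δ (λ I → g (false ∷ I)) J))
      (sumSub-zero {m} λ I → sumFin-zero {suc m} {coboundaryTerm g (false ∷ J) (true ∷ I)} λ
        { zero → zeroˡ _ ; (suc j) → ind-false _ (𝔹.∧-zeroʳ (not (lookup I j))) }))
    (+-identityʳ _)
  coboundary-δ {suc m} g (true ∷ J) = +-cong
    (≈-trans
      (sumSub-cong {m} λ I → ≈-trans
        (+-cong
          (*-cong (reflexive (cong (λ K → ind F (K ==S J)) (Subset.∪-identityʳ I))) (*-identityˡ _))
          (sumFin-zero {m} λ j → ind-false _ (𝔹.∧-zeroʳ (not (lookup I j)))))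
        (+-identityʳ _))
      (sumSub-ind (λ I → g (false ∷ I)) J))
    (begin
      sumSub F (λ I → sumFin F (coboundaryTerm g (true ∷ J) (true ∷ I)))
        ≈⟨ sumSub-cong {m} (λ I → ≈-trans (+-congʳ (zeroˡ _)) (≈-trans (+-identityˡ _)
             (≈-trans (sumFin-cong {m} λ j → ≈-trans (*-congˡ (≈-sym (-‿distribˡ-* _ _))) (≈-sym (-‿distribʳ-* _ _)))
               (sumFin-neg (coboundaryTerm (λ K → g (true ∷ K)) J I))))) ⟩
      sumSub F (λ I → - sumFin F (coboundaryTerm (λ K → g (true ∷ K)) J I))
        ≈⟨ sumSub-neg {m} _ ⟩
      - sumSub F (λ I → sumFin F (coboundaryTerm (λ K → g (true ∷ K)) J I))
        ≈⟨ -‿cong (coboundary-δ (λ K → g (true ∷ K)) J) ⟩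
      - δ (λ K → g (true ∷ K)) J ∎)

  -- The cone on the least vertex of A contracts the cochains of the full simplex on A.
  contract : ∀ {m} → Subset m → (Subset m → Carrier) → Subset m → Carrier
  contract [] g I = 0#
  contract (true ∷ A) g (false ∷ I) = g (true ∷ I)
  contract (true ∷ A) g (true ∷ I) = 0#
  contract (false ∷ A) g (false ∷ I) = contract A (λ J → g (false ∷ J)) I
  contract (false ∷ A) g (true ∷ I) = 0#

  contract-degree : ∀ {m} (A : Subset m) {g d} → (∀ I → ∣ I ∣ ≢ suc d → g I ≈ 0#) →
    ∀ I → ∣ I ∣ ≢ d → contract A g I ≈ 0#
  contract-degree [] h I ≢ = ≈-refl
  contract-degree (true ∷ A) h (false ∷ I) ≢ = h (true ∷ I) (≢ ∘ ℕ.suc-injective)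
  contract-degree (true ∷ A) h (true ∷ I) ≢ = ≈-refl
  contract-degree (false ∷ A) h (false ∷ I) ≢ = contract-degree A (λ J → h (false ∷ J)) I ≢
  contract-degree (false ∷ A) h (true ∷ I) ≢ = ≈-refl

  -- At a set without the least vertex of A, closedness at the set enlarged by that vertex is the
  -- claim. At a set containing it, all other terms vanish, the cone being 0 on such sets. For empty
  -- A only I = ⊥ remains, where g vanishes by its positive degree.
  δ-contract : ∀ {m} (A : Subset m) {g d} → (∀ I → ∣ I ∣ ≢ suc d → g I ≈ 0#) → (∀ {I} → I ≼ A → δ g I ≈ 0#) →
    ∀ {I} → I ≼ A → δ (contract A g) I ≈ g I
  δ-contract [] h closed [] = ≈-sym (h [] λ ())
  δ-contract (false ∷ A) h closed {false ∷ I} (_ ∷ I≼A) =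
    δ-contract A (λ J → h (false ∷ J)) (λ J≼A → closed (b≤b ∷ J≼A)) I≼A
  δ-contract (true ∷ A) {g} h closed {false ∷ I} (_ ∷ I≼A) = ≈-sym (begin
    g (false ∷ I)                      ≈⟨ +-identityʳ _ ⟨
    g (false ∷ I) + 0#                 ≈⟨ +-congˡ (-‿inverseˡ _) ⟨
    g (false ∷ I) + (- x + x)          ≈⟨ +-assoc _ _ _ ⟨
    (g (false ∷ I) + - x) + x          ≈⟨ +-congʳ (closed {true ∷ I} (b≤b ∷ I≼A)) ⟩
    0# + x                             ≈⟨ +-identityˡ _ ⟩
    x                                  ∎)
    where x = δ (λ J → g (true ∷ J)) I
  δ-contract (true ∷ A) {g} h closed {true ∷ I} (_ ∷ I≼A) =
    ≈-trans (+-congˡ (≈-trans (-‿cong (δ-0 I)) -0#≈0#)) (+-identityʳ _)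

  -- Closedness at the least vertex of A, taken as a one-element set: its only facet is the empty
  -- set.
  closed⇒⊥≈0 : ∀ {m} (A : Subset m) {g} → A ≢ ⊥ → (∀ {I} → I ≼ A → δ g I ≈ 0#) → g ⊥ ≈ 0#
  closed⇒⊥≈0 [] ≢⊥ _ = ⊥-elim (≢⊥ refl)
  closed⇒⊥≈0 (false ∷ A) ≢⊥ closed = closed⇒⊥≈0 A (≢⊥ ∘ cong (false ∷_)) (λ I≼A → closed (b≤b ∷ I≼A))
  closed⇒⊥≈0 {suc m} (true ∷ A) {g} ≢⊥ closed = begin
    g (false ∷ ⊥)                                 ≈⟨ +-identityʳ _ ⟨
    g (false ∷ ⊥) + 0#                            ≈⟨ +-congˡ (≈-trans (-‿cong (δ-zero {m} ⊥ (⊥-elim ∘ ¬⋖⊥))) -0#≈0#) ⟨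
    g (false ∷ ⊥) + - δ (λ J → g (true ∷ J)) ⊥    ≈⟨ closed (b≤b ∷ ⊥-≼ A) ⟩
    0#                                            ∎

-- The complex 𝒞(α⃗)

∣∣≡0⇒≡⊥ : ∀ {m} (I : Subset m) → ∣ I ∣ ≡ 0 → I ≡ ⊥
∣∣≡0⇒≡⊥ [] _ = refl
∣∣≡0⇒≡⊥ (false ∷ I) eq = cong (false ∷_) (∣∣≡0⇒≡⊥ I eq)

module Resolution {c ℓ} (F : Field c ℓ) {m : ℕ} (αs : Vec (List ℕ) (suc m))
                  (valid : ∀ j → IsNonemptyComposition (lookup αs j)) where
  open Field F hiding (zero) renaming (refl to ≈-refl; sym to ≈-sym; trans to ≈-trans)
  open import Relation.Binary.Reasoning.Setoid (CommutativeRing.setoid commutativeRing)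
  open Vectors F
  open Koszul F
  open Complex F αs

  private
    n : ℕ
    n = size αs

    k : Skeleton m
    k = skeleton (Vec.head αs) (Vec.tail αs)

    shape-glued : ∀ I → shape I ≡ ribbonOf (glued k I)
    shape-glued = Diag-glued αs valid

    shapeCat-stacked : shapeCat ≡ ribbonOf (stacked k)
    shapeCat-stacked = Diag-stacked αs valid

    n≡ : ∀ S → n ≡ suc (length (fill k S))
    n≡ S = trans (go αs valid) (cong suc (sym (length-fill k S)))
      where
      go : ∀ {m} (αs : Vec (List ℕ) (suc m)) → AllNonempty αs → size αs ≡ suc (width (skeleton (Vec.head αs) (Vec.tail αs)))
      go (α ∷ αs) = size-width α αs

    syt-fill⁻ : ∀ {D} S → D ≡ ribbonOf (fill k S) → ∀ {U} → U ∈ syt D → U ↭ oneTo n × Steps Ok (fill k S) U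
    syt-fill⁻ S refl U∈ rewrite n≡ S = ∈-syt-ribbonOf⁻ (fill k S) U∈

    syt-fill⁺ : ∀ {D} S → D ≡ ribbonOf (fill k S) → ∀ {U} → U ↭ oneTo n → Steps Ok (fill k S) U → U ∈ syt D
    syt-fill⁺ S refl U↭ oks rewrite n≡ S = ∈-syt-ribbonOf⁺ (fill k S) U↭ oks

    fill-reflects : ∀ {D} S → D ≡ ribbonOf (fill k S) → ∀ {i} → Gen n i → SortReflects D i
    fill-reflects S refl {i} (1≤i , i<n) = sortEntries-reflects-syt i (fill k S) 1≤i (subst (i <_) (n≡ S) i<n)

    standard⁻ : ∀ I {U} → U ∈ syt (shape I) → U ↭ oneTo n × Steps Ok (glued k I) U
    standard⁻ I = syt-fill⁻ _ (shape-glued I)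

    standard⁺ : ∀ I {U} → U ↭ oneTo n → Steps Ok (glued k I) U → U ∈ syt (shape I)
    standard⁺ I = syt-fill⁺ _ (shape-glued I)

    reflects : ∀ I {i} → Gen n i → SortReflects (shape I) i
    reflects I = fill-reflects _ (shape-glued I)

    reflectsCat : ∀ {i} → Gen n i → SortReflects shapeCat i
    reflectsCat = fill-reflects _ shapeCat-stacked

    unique : ∀ {U} → U ↭ oneTo n → Unique U
    unique U↭ = Unique-resp-↭ (↭-sym U↭) (oneTo-unique n)

    A : Filling → Subset m
    A = ascents k

    standard⇒≼A : ∀ I {U} → U ∈ syt (shape I) → I ≼ A U
    standard⇒≼A I U∈ = glued⇒≼ascents k (proj₂ (standard⁻ I U∈))

    standard-change : ∀ {I} J {U} → U ∈ syt (shape I) → J ≼ A U → U ∈ syt (shape J)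
    standard-change {I} J U∈ J≼ with U↭ , oks ← standard⁻ I U∈ = standard⁺ J U↭ (glued-change k oks J≼)

    standard-⋖ : ∀ {I J U} → I ⋖ J → U ∈ syt (shape J) → U ∈ syt (shape I)
    standard-⋖ {I} {J} I⋖J U∈ = standard-change I U∈ (≼-trans (⋖⇒≼ I⋖J) (standard⇒≼A J U∈))

    cat⇒standard : ∀ {U} → U ∈ syt shapeCat → U ∈ syt (shape ⊥)
    cat⇒standard U∈ with U↭ , oks ← syt-fill⁻ _ shapeCat-stacked U∈ = standard⁺ ⊥ U↭ (stacked⇒glued k oks)

    cat⇒A≡⊥ : ∀ {U} → U ∈ syt shapeCat → A U ≡ ⊥
    cat⇒A≡⊥ U∈ = stacked⇒ascents≡⊥ k (proj₂ (syt-fill⁻ _ shapeCat-stacked U∈))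

    A≡⊥⇒cat : ∀ {U} → U ∈ syt (shape ⊥) → A U ≡ ⊥ → U ∈ syt shapeCat
    A≡⊥⇒cat U∈ eq with U↭ , oks ← standard⁻ ⊥ U∈ =
      syt-fill⁺ _ shapeCat-stacked U↭ (ascents≡⊥⇒stacked k (unique U↭) oks eq)

    cat∩standard : ∀ I {U} → U ∈ syt (shape I) → U ∈ syt shapeCat → I ≡ ⊥
    cat∩standard I U∈ U∈′ = ≼-⊥ (subst (I ≼_) (cat⇒A≡⊥ U∈′) (standard⇒≼A I U∈))

    sort-precedes : ∀ I {i U} → Gen n i → U ∈ syt (shape I) →
      sortEntries (shape I) i U ≡ (if precedes (suc i) i U then swapEntries i U else U)
    sort-precedes I {i} {U} (1≤i , i<n) U∈ with U↭ , oks ← standard⁻ I U∈ rewrite shape-glued I =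
      cong (λ b → if b then swapEntries i U else U) (rowOf-precedes i 0 0 oks
        (↭.∈-resp-↭ (↭-sym U↭) (∈-oneTo⁺ 1≤i (ℕ.<⇒≤ i<n)))
        (↭.∈-resp-↭ (↭-sym U↭) (∈-oneTo⁺ (s≤s z≤n) i<n)))

    sort-⋖ : ∀ {I J i U} → Gen n i → I ⋖ J → U ∈ syt (shape J) → sortEntries (shape I) i U ≡ sortEntries (shape J) i U
    sort-⋖ {I} {J} g I⋖J U∈ = trans (sort-precedes I g (standard-⋖ I⋖J U∈)) (sym (sort-precedes J g U∈))

    -- If the sorted filling is not standard for J, then π_i (∂ v) has coefficient 0 at U. By this
    -- lemma the sorted filling is then standard for no I, so every term of ∂ (π_i v) vanishes as
    -- well.
    sort-standard : ∀ I J {i U} → Gen n i → U ∈ syt (shape J) →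
      sortEntries (shape J) i U ∈ syt (shape I) → sortEntries (shape J) i U ∈ syt (shape J)
    sort-standard I J {i} {U} g U∈ V∈ with rowOf (shape J) U (suc i) ℕ.<? rowOf (shape J) U i
    ... | no ≮ rewrite sortEntries-keep (shape J) {i} {U} ≮ = U∈
    ... | yes lt rewrite sortEntries-swap (shape J) {i} {U} lt with U↭ , oks ← standard⁻ J U∈ | V↭ , oks′ ← standard⁻ I V∈ =
      standard⁺ J V↭ (glued-swap k J i (unique U↭) oks
        (ℕ.<⇒≢ (subst (λ D → rowOf D U (suc i) < rowOf D U i) (shape-glued J) lt)) oks′)

    sort-cat : ∀ i U → sortEntries (shape ⊥) i U ≡ sortEntries shapeCat i U
    sort-cat i U rewrite shape-glued ⊥ | shapeCat-stacked
      | rowOf-stacked k 0 0 0 U (suc i) | rowOf-stacked k 0 0 0 U i = refl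

    at : C → Filling → Subset m → Carrier
    at v U I = hat (shape I) (v I) U

    ∂-δ : ∀ v J t → ∂ v J t ≈ δ (at v (tab (shape J) t)) J
    ∂-δ v J t = coboundary-δ (at v (tab (shape J) t)) J

    at-∂ : ∀ v J {U} → U ∈ syt (shape J) → at (∂ v) U J ≈ δ (at v U) J
    at-∂ v J U∈ with t , refl ← ∈⇒tab (shape J) U∈ = ≈-trans (hat-tab (shape J) _ t) (∂-δ v J t)

    at-tab : ∀ v I t → at v (tab (shape I) t) I ≈ v I t
    at-tab v I t = hat-tab (shape I) (v I) t

    ∂-degree : ∀ d v → InDegree d v → InDegree (suc d) (∂ v)
    ∂-degree d v deg J ne t = ≈-trans (∂-δ v J t) (δ-zero J λ {I} I⋖J →
      hat-zero (shape I) _ (deg I λ eq → ne (trans (⋖⇒∣∣ I⋖J) (cong suc eq))))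

    ∂-+ : ∀ v w → ∂ (v +C w) ≈C (∂ v +C ∂ w)
    ∂-+ v w J t = begin
      ∂ (v +C w) J t                       ≈⟨ ∂-δ (v +C w) J t ⟩
      δ (at (v +C w) U) J                  ≈⟨ δ-cong J (λ {I} _ → hat-+ (shape I) (v I) (w I) U) ⟩
      δ (λ I → at v U I + at w U I) J      ≈⟨ δ-+ _ _ J ⟩
      δ (at v U) J + δ (at w U) J          ≈⟨ +-cong (∂-δ v J t) (∂-δ w J t) ⟨
      ∂ v J t + ∂ w J t                    ∎
      where U = tab (shape J) t

    ∂-· : ∀ a v → ∂ (a ·C v) ≈C (a ·C ∂ v)
    ∂-· a v J t = begin
      ∂ (a ·C v) J t              ≈⟨ ∂-δ (a ·C v) J t ⟩
      δ (at (a ·C v) U) J         ≈⟨ δ-cong J (λ {I} _ → hat-* (shape I) a (v I) U) ⟩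
      δ (λ I → a * at v U I) J    ≈⟨ δ-* a _ J ⟩
      a * δ (at v U) J            ≈⟨ *-congˡ (∂-δ v J t) ⟨
      a * ∂ v J t                 ∎
      where U = tab (shape J) t

    -- All facets I ⋖ J sort the word U in the same way as J does, so the coboundary of π_i v at U
    -- is that of v at the single filling V.
    ∂-π : ∀ i → Gen n i → ∀ v → ∂ (πC i v) ≈C πC i (∂ v)
    ∂-π i g v J t = ≈-trans (∂-δ (πC i v) J t) (≈-trans
      (δ-cong J λ {I} I⋖J → ≈-trans (hat-π (shape I) i (reflects I g) (v I) U)
        (reflexive (cong (λ W → at v W I) (sort-⋖ g I⋖J U∈))))
      (≈-trans finish (≈-sym (π-hat (shape J) i (∂ v J) t))))
      where
      U V : Filling
      U = tab (shape J) t
      V = sortEntries (shape J) i U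
      U∈ : U ∈ syt (shape J)
      U∈ = tab-∈ (shape J) t
      finish : δ (at v V) J ≈ at (∂ v) V J
      finish with V ∈F? syt (shape J)
      ... | yes V∈ = ≈-sym (at-∂ v J V∈)
      ... | no V∉ = ≈-trans (δ-zero J λ {I} _ → hat-∉ (shape I) (v I) (V∉ ∘ sort-standard I J g U∈))
        (≈-sym (hat-∉ (shape J) (∂ v J) V∉))

    ∂-∂ : ∀ v → ∂ (∂ v) ≈C 0C
    ∂-∂ v J t = ≈-trans (∂-δ (∂ v) J t) (≈-trans
      (δ-cong J λ {I} I⋖J → at-∂ v I (standard-⋖ I⋖J (tab-∈ (shape J) t)))
      (δ-δ (at v (tab (shape J) t)) J))

    -- A word standard for some J is standard for every I below its ascent set, so ∂ v = 0 yields
    -- closedness on the whole simplex on A(U).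
    closed-at : ∀ {v} → ∂ v ≈C 0C → ∀ {J U} → U ∈ syt (shape J) → ∀ {I} → I ≼ A U → δ (at v U) I ≈ 0#
    closed-at {v} ∂v≈0 U∈ {I} I≼A = ≈-trans (≈-sym (at-∂ v I (standard-change I U∈ I≼A))) (hat-zero (shape I) _ (∂v≈0 I))

  isCochainComplex : IsCochainComplexOfModules n
  isCochainComplex =
    (λ i g v I → π-idem (shape I) i (reflects I g) (v I)) ,
    (λ i g g′ v I → π-braid (shape I) i (reflects I g) (reflects I g′) (v I)) ,
    (λ i j g g′ far v I → π-comm (shape I) i j (reflects I g) (reflects I g′)
      (λ { refl → [ ℕ.<-asym (ℕ.n<1+n i) , ℕ.<-asym (ℕ.n<1+n i) ]′ far })
      (λ { refl → [ ℕ.<-asym (ℕ.m<n⇒m<1+n (ℕ.n<1+n j)) , ℕ.<-irrefl refl ]′ far })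
      (λ { refl → [ ℕ.<-irrefl refl , ℕ.<-asym (ℕ.m<n⇒m<1+n (ℕ.n<1+n i)) ]′ far }) (v I)) ,
    ∂-degree , ∂-+ , ∂-· , ∂-π , ∂-∂

  isAcyclic : IsAcyclicInPositiveDegrees
  isAcyclic d v deg ∂v≈0 = w , w-degree , ∂w≈v
    where
    at-degree : ∀ U I → ∣ I ∣ ≢ suc d → at v U I ≈ 0#
    at-degree U I ne = hat-zero (shape I) U (deg I ne)
    w : C
    -- The apex of the cone varies with the filling, through its ascent set.
    w I t = contract (A (tab (shape I) t)) (at v (tab (shape I) t)) I
    w-degree : InDegree d w
    w-degree I ne t = contract-degree (A (tab (shape I) t)) (at-degree _) I ne
    at-w : ∀ I {U} → U ∈ syt (shape I) → at w U I ≈ contract (A U) (at v U) I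
    at-w I U∈ with t , refl ← ∈⇒tab (shape I) U∈ = at-tab w I t
    ∂w≈v : ∂ w ≈C v
    ∂w≈v J t = begin
      ∂ w J t                              ≈⟨ ∂-δ w J t ⟩
      δ (at w U) J                         ≈⟨ δ-cong J (λ {I} I⋖J → at-w I (standard-⋖ I⋖J U∈)) ⟩
      δ (contract (A U) (at v U)) J        ≈⟨ δ-contract (A U) (at-degree U) (closed-at {v} ∂v≈0 {J} U∈) (standard⇒≼A J U∈) ⟩
      at v U J                             ≈⟨ at-tab v J t ⟩
      v J t                                ∎
      where
      U = tab (shape J) t
      U∈ = tab-∈ (shape J) t

  -- Extension by zero: it lands in degree 0, a filling standard for the concatenation having no ascent at a comma.
  embed : P F shapeCat → C
  embed u I t = hat shapeCat u (tab (shape I) t)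

  private
    embed-⊥ : ∀ u I {U} → U ∈ syt (shape I) → I ≢ ⊥ → hat shapeCat u U ≈ 0#
    embed-⊥ u I U∈ I≢⊥ = hat-∉ shapeCat u λ U∈′ → I≢⊥ (cat∩standard I U∈ U∈′)

    at-embed : ∀ u I {U} → U ∈ syt (shape I) → at (embed u) U I ≈ hat shapeCat u U
    at-embed u I U∈ with t , refl ← ∈⇒tab (shape I) U∈ = at-tab (embed u) I t

    -- For I = ⊥ the two diagrams have the same rows and sort alike; for I ≠ ⊥ both sides are 0.
    embed-π : ∀ i → Gen n i → ∀ u → embed (π F shapeCat i u) ≈C πC i (embed u)
    embed-π i g u I t = ≈-trans (hat-π shapeCat i (reflectsCat g) u U)
      (≈-trans (go (∣ I ∣ ℕ.≟ 0)) (≈-sym (π-hat (shape I) i (embed u I) t)))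
      where
      U V : Filling
      U = tab (shape I) t
      V = sortEntries (shape I) i U
      U∈ : U ∈ syt (shape I)
      U∈ = tab-∈ (shape I) t
      go : _ → hat shapeCat u (sortEntries shapeCat i U) ≈ at (embed u) V I
      go (yes eq) with refl ← ∣∣≡0⇒≡⊥ I eq rewrite sym (sort-cat i U) with V ∈F? syt (shape I)
      ... | yes V∈ = ≈-sym (at-embed u I V∈)
      ... | no V∉ = ≈-trans (hat-∉ shapeCat u (V∉ ∘ cat⇒standard)) (≈-sym (hat-∉ (shape I) (embed u I) V∉))
      -- Were the sorted filling standard for the concatenation, U would be as well by reflection;
      -- being standard for α⃗(I), it would force I = ⊥.
      go (no ne) = ≈-trans
        (hat-∉ shapeCat u λ U∈′ → I≢⊥ (cat∩standard I U∈ (reflectsCat g U∈′)))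
        (≈-sym zeroAt)
        where
        I≢⊥ : I ≢ ⊥
        I≢⊥ refl = ne (Subset.∣⊥∣≡0 m)
        zeroAt : at (embed u) V I ≈ 0#
        zeroAt with V ∈F? syt (shape I)
        ... | yes V∈ = ≈-trans (at-embed u I V∈) (embed-⊥ u I V∈ I≢⊥)
        ... | no V∉ = hat-∉ (shape I) (embed u I) V∉

    embed-degree : ∀ u → InDegree 0 (embed u)
    embed-degree u I ne t = embed-⊥ u I (tab-∈ (shape I) t) λ { refl → ne (Subset.∣⊥∣≡0 m) }

    -- Up to sign, each term of the coboundary at J is the coefficient of u at one and the same
    -- word. It is 0, because the word ascends at the commas in J and J is nonempty whenever I ⋖ J.
    embed-closed : ∀ u → ∂ (embed u) ≈C 0C
    embed-closed u J t = ≈-trans (∂-δ (embed u) J t) (δ-zero J λ {I} I⋖J →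
      ≈-trans (at-embed u I (standard-⋖ I⋖J (tab-∈ (shape J) t)))
        (embed-⊥ u J (tab-∈ (shape J) t) λ { refl → ¬⋖⊥ I⋖J }))

    embed-injective : ∀ u w → embed u ≈C embed w → u ≈P w
    embed-injective u w eq s with t , eq′ ← ∈⇒tab (shape ⊥) (cat⇒standard (tab-∈ shapeCat s)) = begin
      u s                                ≈⟨ hat-at shapeCat u s (sym eq′) ⟨
      hat shapeCat u (tab (shape ⊥) t)   ≈⟨ eq ⊥ t ⟩
      hat shapeCat w (tab (shape ⊥) t)   ≈⟨ hat-at shapeCat w s (sym eq′) ⟩
      w s                                ∎

    embed-surjective : ∀ v → InDegree 0 v → ∂ v ≈C 0C → ∃ λ u → embed u ≈C v
    embed-surjective v deg ∂v≈0 = u , λ I t → go I t (∣ I ∣ ℕ.≟ 0)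
      where
      u : P F shapeCat
      u s = at v (tab shapeCat s) ⊥
      go : ∀ I t → _ → embed u I t ≈ v I t
      go I t (no ne) = ≈-trans (embed-degree u I ne t) (≈-sym (deg I ne t))
      go I t (yes eq) with refl ← ∣∣≡0⇒≡⊥ I eq with tab (shape ⊥) t ∈F? syt shapeCat
      ... | yes U∈ with s , eq′ ← ∈⇒tab shapeCat U∈ = ≈-trans (hat-at shapeCat u s eq′) (hat-at (shape ⊥) (v ⊥) t (sym eq′))
      -- Such a word ascends at some comma, and closedness at that comma kills its coefficient in v.
      ... | no U∉ = ≈-trans (hat-∉ shapeCat u U∉) (≈-sym (≈-trans (≈-sym (at-tab v ⊥ t))
        (closed⇒⊥≈0 (A (tab (shape ⊥) t)) (U∉ ∘ A≡⊥⇒cat (tab-∈ (shape ⊥) t))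
          (closed-at {v} ∂v≈0 {⊥} (tab-∈ (shape ⊥) t)))))

  h0Iso : H0Iso n
  h0Iso = embed ,
    (λ u w eq I t → hat-cong shapeCat _ eq) ,
    (λ u w I t → hat-+ shapeCat u w (tab (shape I) t)) ,
    (λ a u I t → hat-* shapeCat a u (tab (shape I) t)) ,
    embed-π , embed-degree , embed-closed , embed-injective , embed-surjective

theorem5p6 : ∀ {c ℓ} (F : Field c ℓ) (m : ℕ) (αs : Vec (List ℕ) (suc m)) →
    (∀ (j : Fin (suc m)) → IsNonemptyComposition (lookup αs j)) →
    let open Complex F αs in
    IsCochainComplexOfModules (size αs) × IsAcyclicInPositiveDegrees × H0Iso (size αs)
theorem5p6 F m αs valid = isCochainComplex , isAcyclic , h0Iso
  where open Resolution F αs valid
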